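{- Up to isomorphism of MR geometries and interchanging the two colours, the only MR geometries on $v\le 15$ points are the following ten: $\mathsf{MR}_{12}$, $\mathsf{MR}_{13}$, $\mathsf{MR}_{14}^1$, $\mathsf{MR}_{14}^2$, $\mathsf{MR}_{15}^1$, $\mathsf{MR}_{15}^2$, $\mathsf{MR}_{15}^{3\mathsf r}$, $\mathsf{MR}_{15}^{3\mathsf g}$, $\mathsf{MR}_{15}^4$, $\mathsf{MR}_{15}^5$, as defined in the context.
   Context: A finite linear space (f.l.s.) consists of a finite set of points and a set of lines (sets of points) such that any two distinct points lie on exactly one common line, every line has at least two points, and not all points are on one line. For a set $T$ of points not all on one line, the subspace induced by $T$ has point set $T$ and lines the sets $\ell\cap T$ with $|\ell\cap T|\ge2$. An MR geometry is an f.l.s. together with a colouring of each point red or green such that every line contains at least one red and at least one green point. An isomorphism of MR geometries is an isomorphism of the underlying f.l.s. mapping red points to red points and green to green. $\mathsf{PG}(2,3)$: let $A,B,C,D$ be four points of the projective plane of order $3$, no three collinear, and $E=AB\cap CD$, $F=AC\cap BD$, $H=AD\cap BC$. $\mathsf{MR}_{13}$ is $\mathsf{PG}(2,3)$ with $A,B,C,D,E,F,H$ green and the remaining six points red. $\mathsf{MR}_{12}$ is the subspace of $\mathsf{MR}_{13}$ induced by all points except $H$, with the inherited colouring. $\mathsf{PG}(2,4)$ is represented with point set $\{i_j : i\in\mathbb Z_7, j\in\mathbb Z_3\}$ and the $21$ lines $\{i_j,(i+1)_j,(i+3)_j,f(i)_{j+1},f(i)_{j+2}\}$ ($i\in\mathbb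 Z_7$, $j\in\mathbb Z_3$), where $f(0)=6,f(1)=3,f(2)=0,f(3)=5,f(4)=1,f(5)=2,f(6)=4$. All MR geometries below (except $\mathsf{MR}_{15}^2$) are subspaces of $\mathsf{PG}(2,4)$ induced by the listed point sets. $\mathsf{MR}_{14}^1$: points $\{i_0\}\cup\{i_1\}$ ($i\in\mathbb Z_7$), each $i_0$ green, each $i_1$ red. $\mathsf{MR}_{14}^2$: points $\{i_0:i\in\mathbb Z_7\}\cup\{2_1,4_1,5_1,6_1,0_2,1_2,3_2\}$, each $i_0$ green, the others red. $\mathsf{MR}_{15}^1$: points of $\mathsf{MR}_{14}^1$ together with $6_2$, coloured as in $\mathsf{MR}_{14}^1$ and $6_2$ green. $\mathsf{MR}_{15}^2$: take $\mathsf{MR}_{14}^1$ (in which each $\{i_0,i_1\}$ is a $2$-point line), add a new green point $\infty$, and replace each line $\{i_0,i_1\}$ ($i\in\mathbb Z_7$) by $\{i_0,i_1,\infty\}$; all other lines unchanged. $\mathsf{MR}_{15}^{3\mathsf r}$ and $\mathsf{MR}_{15}^{3\mathsf g}$: points of $\mathsf{MR}_{14}^2$ together with $4_2$, coloured as in $\mathsf{MR}_{14}^2$ with $4_2$ red, respectively green. $\mathsf{MR}_{15}^4$: points of $\mathsf{MR}_{14}^2$ together with $3_1$, with $3_1$ red. $\mathsf{MR}_{15}^5$: all points of $\mathsf{PG}(2,4)$ except $0_1,1_1,3_1,6_2,0_2,3_2$; green points $0_0,1_0,3_0,4_0,5_1,1_2,5_2$; red points $2_0,5_0,6_0,2_1,4_1,6_1,2_2,4_2$.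 -}

module Defs where

open import Data.Bool using (Bool; true; false; _∧_; _∨_; not; if_then_else_)
open import Data.Nat using (ℕ; zero; suc; _≤_; _≤?_; _+_; _*_; _≡ᵇ_; _%_)
open import Data.Nat.Properties using () renaming (_≟_ to _≟ℕ_)
open import Data.Nat.DivMod using (_mod_)
open import Data.Fin using (Fin; toℕ; #_)
open import Data.Fin.Subset using (Subset; _∈_; _∉_; ∣_∣)
open import Data.Fin.Properties using () renaming (_≟_ to _≟F_)
open import Data.List using (List; []; _∷_; _++_; length; lookup; filter; filterᵇ; map; concatMap; allFin)
open import Data.Bool.ListAction using (any)
open import Data.Vec using (Vec; tabulate)
import Data.Vec as Vec
open import Data.Product using (Σ; Σ-syntax; ∃; _×_; _,_; proj₁; proj₂)
open import Data.Product.Properties using (≡-dec)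
open import Data.Maybe using (Maybe; just; nothing)
open import Data.Maybe.Properties using () renaming (≡-dec to ≡-decM)
open import Relation.Nullary using (¬_; does)
open import Relation.Binary.Definitions using (DecidableEquality)
open import Relation.Binary.PropositionalEquality using (_≡_; _≢_)
open import Function.Bundles using (_↔_; Inverse)

data Colour : Set where
  red green : Colour

swapColour : Colour → Colour
swapColour red   = green
swapColour green = red

record Geom : Set where
  field
    pts    : ℕ
    nlines : ℕ
    line   : Fin nlines → Subset pts
    colour : Fin pts → Colour
open Geom public

record IsFLS (G : Geom) : Set where
  field
    lineSize : ∀ l → 2 ≤ ∣ line G l ∣
    unique   : ∀ x y → x ≢ y →
               Σ[ l ∈ Fin (nlines G) ] ((x ∈ line G l × y ∈ line G l) ×
                 (∀ l' → x ∈ line G l' → y ∈ line G l' → l' ≡ l))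
    twoPoints  : 2 ≤ pts G
    notOneLine : ¬ (Σ[ l ∈ Fin (nlines G) ] (∀ x → x ∈ line G l))

record IsMR (G : Geom) : Set where
  field
    fls      : IsFLS G
    hasRed   : ∀ l → Σ[ x ∈ Fin (pts G) ] (x ∈ line G l × colour G x ≡ red)
    hasGreen : ∀ l → Σ[ x ∈ Fin (pts G) ] (x ∈ line G l × colour G x ≡ green)

swapColours : Geom → Geom
swapColours G = record
  { pts = pts G ; nlines = nlines G ; line = line G
  ; colour = λ x → swapColour (colour G x) }

record Iso (G H : Geom) : Set where
  field
    ptIso   : Fin (pts G) ↔ Fin (pts H)
    lineIso : Fin (nlines G) ↔ Fin (nlines H)
    incid   : ∀ x l → (x ∈ line G l → Inverse.to ptIso x ∈ line H (Inverse.to lineIso l))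
                    × (Inverse.to ptIso x ∈ line H (Inverse.to lineIso l) → x ∈ line G l)
    colours : ∀ x → colour H (Inverse.to ptIso x) ≡ colour G x

-- Induced subspaces of an ambient incidence structure (points of type P,
-- lines given as lists of points).  Given the list T of the chosen points
-- (without repetition) with their colours, the induced structure has point
-- k : Fin (length T) standing for the k-th point of T, and lines the sets
-- ℓ ∩ T with |ℓ ∩ T| ≥ 2.

module _ {P : Set} (_≟_ : DecidableEquality P) where

  mem : P → List P → Bool
  mem p []       = false
  mem p (q ∷ qs) = does (p ≟ q) ∨ mem p qs

  traceOn : (T : List (P × Colour)) → List P → Subset (length T)
  traceOn T ℓ = tabulate (λ k → mem (proj₁ (lookup T k)) ℓ)

  inducedLines : (L : List (List P)) (T : List (P × Colour)) → List (Subset (length T))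
  inducedLines L T = filter (λ S → 2 ≤? ∣ S ∣) (map (traceOn T) L)

  induced : List (List P) → List (P × Colour) → Geom
  induced L T = record
    { pts    = length T
    ; nlines = length (inducedLines L T)
    ; line   = lookup (inducedLines L T)
    ; colour = λ k → proj₂ (lookup T k) }

-- PG(2,3) as the projective plane over GF(3): points are the normalised
-- nonzero vectors of GF(3)^3 (first nonzero coordinate 1), coordinates
-- in {0,1,2}; the line with dual coordinates u is {p | u·p ≡ 0 (mod 3)}.

P3 : Set
P3 = ℕ × ℕ × ℕ

_≟P3_ : DecidableEquality P3
_≟P3_ = ≡-dec _≟ℕ_ (≡-dec _≟ℕ_ _≟ℕ_)

GF3 : List ℕ
GF3 = 0 ∷ 1 ∷ 2 ∷ []

points-PG23 : List P3
points-PG23 =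
  concatMap (λ a → map (λ b → (1 , a , b)) GF3) GF3
  ++ map (λ b → (0 , 1 , b)) GF3
  ++ (0 , 0 , 1) ∷ []

dot3 : P3 → P3 → ℕ
dot3 (a , b , c) (x , y , z) = (a * x + b * y + c * z) % 3

lines-PG23 : List (List P3)
lines-PG23 = map (λ u → filterᵇ (λ p → dot3 u p ≡ᵇ 0) points-PG23) points-PG23

-- The frame A, B, C, D (no three collinear) and the diagonal points
-- E = AB ∩ CD, F = AC ∩ BD, H = AD ∩ BC.
ptA ptB ptC ptD ptE ptF ptH : P3
ptA = (1 , 0 , 0)
ptB = (0 , 1 , 0)
ptC = (0 , 0 , 1)
ptD = (1 , 1 , 1)
ptE = (1 , 1 , 0)   -- on AB : z = 0  and on CD = span{C , D}
ptF = (1 , 0 , 1)   -- on AC : y = 0  and on BD = span{B , D}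
ptH = (0 , 1 , 1)   -- on BC : x = 0  and on AD = span{A , D}

greens13 : List P3
greens13 = ptA ∷ ptB ∷ ptC ∷ ptD ∷ ptE ∷ ptF ∷ ptH ∷ []

colour13 : P3 → Colour
colour13 p with mem _≟P3_ p greens13
... | true  = green
... | false = red

MR13 : Geom
MR13 = induced _≟P3_ lines-PG23 (map (λ p → (p , colour13 p)) points-PG23)

MR12 : Geom
MR12 = induced _≟P3_ lines-PG23
         (map (λ p → (p , colour13 p))
              (filterᵇ (λ p → not (does (p ≟P3 ptH))) points-PG23))

-- PG(2,4): points i_j (i ∈ ℤ₇, j ∈ ℤ₃), represented as pairs (i , j),
-- lines {i_j, (i+1)_j, (i+3)_j, f(i)_{j+1}, f(i)_{j+2}}.

P4 : Set
P4 = Fin 7 × Fin 3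

_≟P4_ : DecidableEquality P4
_≟P4_ = ≡-dec _≟F_ _≟F_

_+₇_ : Fin 7 → ℕ → Fin 7
i +₇ k = (toℕ i + k) mod 7

_+₃_ : Fin 3 → ℕ → Fin 3
j +₃ k = (toℕ j + k) mod 3

f₇ : Fin 7 → Fin 7
f₇ i = Vec.lookup (# 6 Vec.∷ # 3 Vec.∷ # 0 Vec.∷ # 5 Vec.∷ # 1 Vec.∷ # 2 Vec.∷ # 4 Vec.∷ Vec.[]) i

pgLine : Fin 7 → Fin 3 → List P4
pgLine i j = (i , j) ∷ (i +₇ 1 , j) ∷ (i +₇ 3 , j) ∷ (f₇ i , j +₃ 1) ∷ (f₇ i , j +₃ 2) ∷ []

lines-PG24 : List (List P4)
lines-PG24 = concatMap (λ i → map (pgLine i) (allFin 3)) (allFin 7)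

_₍_₎ : ℕ → ℕ → P4
i ₍ j ₎ = (i mod 7 , j mod 3)

greenAll : Fin 3 → Colour → List (P4 × Colour)
greenAll j c = map (λ i → ((i , j) , c)) (allFin 7)

sub4 : List (P4 × Colour) → Geom
sub4 = induced _≟P4_ lines-PG24

T14-1 : List (P4 × Colour)
T14-1 = greenAll (# 0) green ++ greenAll (# 1) red

T14-2 : List (P4 × Colour)
T14-2 = greenAll (# 0) green ++
        (2 ₍ 1 ₎ , red) ∷ (4 ₍ 1 ₎ , red) ∷ (5 ₍ 1 ₎ , red) ∷ (6 ₍ 1 ₎ , red) ∷
        (0 ₍ 2 ₎ , red) ∷ (1 ₍ 2 ₎ , red) ∷ (3 ₍ 2 ₎ , red) ∷ []

MR14-1 MR14-2 MR15-1 MR15-3r MR15-3g MR15-4 MR15-5 : Geom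
MR14-1  = sub4 T14-1
MR14-2  = sub4 T14-2
MR15-1  = sub4 (T14-1 ++ (6 ₍ 2 ₎ , green) ∷ [])
MR15-3r = sub4 (T14-2 ++ (4 ₍ 2 ₎ , red) ∷ [])
MR15-3g = sub4 (T14-2 ++ (4 ₍ 2 ₎ , green) ∷ [])
MR15-4  = sub4 (T14-2 ++ (3 ₍ 1 ₎ , red) ∷ [])
MR15-5  = sub4
  ( (0 ₍ 0 ₎ , green) ∷ (1 ₍ 0 ₎ , green) ∷ (3 ₍ 0 ₎ , green) ∷ (4 ₍ 0 ₎ , green) ∷
    (5 ₍ 1 ₎ , green) ∷ (1 ₍ 2 ₎ , green) ∷ (5 ₍ 2 ₎ , green) ∷
    (2 ₍ 0 ₎ , red) ∷ (5 ₍ 0 ₎ , red) ∷ (6 ₍ 0 ₎ , red) ∷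
    (2 ₍ 1 ₎ , red) ∷ (4 ₍ 1 ₎ , red) ∷ (6 ₍ 1 ₎ , red) ∷
    (2 ₍ 2 ₎ , red) ∷ (4 ₍ 2 ₎ , red) ∷ [] )

-- MR15^2: points of MR14^1 plus a new green point ∞ (= nothing); every
-- line of MR14^1 of the form {i_0 , i_1} gets ∞ added, other lines stay.
-- An ambient line ℓ of PG(2,4) traces {i_0 , i_1} on the point set of
-- MR14^1 iff it contains i_0 and i_1 and exactly two points of that set.

pts14-1 : List P4
pts14-1 = map proj₁ T14-1

count14-1 : List P4 → ℕ
count14-1 ℓ = length (filterᵇ (λ p → mem _≟P4_ p pts14-1) ℓ)

isPairLine : List P4 → Bool
isPairLine ℓ = any (λ i → mem _≟P4_ (i , # 0) ℓ ∧ mem _≟P4_ (i , # 1) ℓ ∧ (count14-1 ℓ ≡ᵇ 2)) (allFin 7)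

extLine : List P4 → List (Maybe P4)
extLine ℓ = map just ℓ ++ (if isPairLine ℓ then nothing ∷ [] else [])

MR15-2 : Geom
MR15-2 = induced (≡-decM _≟P4_) (map extLine lines-PG24)
           (map (λ { (p , c) → (just p , c) }) T14-1 ++ (nothing , green) ∷ [])

MRlist : Fin 10 → Geom
MRlist i = Vec.lookup
  (MR12 Vec.∷ MR13 Vec.∷ MR14-1 Vec.∷ MR14-2 Vec.∷ MR15-1 Vec.∷ MR15-2 Vec.∷
   MR15-3r Vec.∷ MR15-3g Vec.∷ MR15-4 Vec.∷ MR15-5 Vec.∷ Vec.[]) i

{-# OPTIONS --safe #-}

-- Up to interchanging the colours at most 7 points are green, and they form
-- one of the finitely many linear spaces on at most 7 points.  Once all green
-- points are known, a new red point is described by the known lines through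
-- it: they are pairwise disjoint, and they cover all red points found so far,
-- because every line contains a green point.  While some line is still
-- monochromatic, a further red point lies on it, and distinct monochromatic
-- lines through a green point need distinct further red points.  Identifying
-- isomorphic configurations, these constraints leave a search of about a
-- thousand cases, done by evaluation.  Among the ten geometries found, the sum
-- of r³ + g³ over all lines, with r red and g green points, separates all.

module Submission where

open import Defs
open import Data.Bool using (Bool; true; false; _∧_; _∨_; not; if_then_else_; T)
open import Data.Bool.ListAction using (any; all)
open import Data.Bool.Properties using (T-≡; T-∧; T-∨; T?; not-involutive)
open import Data.Empty using (⊥-elim)
open import Data.Fin using (Fin; zero; suc; cast)
import Data.Fin.Properties as Fin
open import Data.Fin.Properties using () renaming (_≟_ to _≟F_)
import Data.Fin.Subset as Subset
open import Data.List using (List; []; _∷_; _++_; map; filterᵇ; length; replicate; concatMap; foldr; null; upTo; allFin; lookup; tabulate; zipWith)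
open import Data.List.Properties using (map-cong-local; map-∘; length-map; length-++; length-tabulate; map-tabulate; ∷-injectiveˡ; ∷-injectiveʳ)
import Data.List.Membership.DecPropositional as DecMembership
open import Data.List.Membership.Propositional using (_∈_; _∉_; find)
open import Data.List.Membership.Propositional.Properties using (∈-map⁺; ∈-map⁻; ∈-++⁺ˡ; ∈-++⁺ʳ; ∈-++⁻; ∈-filter⁺; ∈-filter⁻; ∈-concatMap⁺; ∈-concatMap⁻; ∈-lookup; ∈-allFin; ∈-upTo⁺)
open import Data.List.Membership.Propositional.Properties.WithK using (unique∧set⇒bag)
open import Data.List.Relation.Binary.BagAndSetEquality using (∼bag⇒↭)
open import Data.List.Relation.Binary.Permutation.Propositional using (_↭_; ↭-refl; ↭-sym; ↭-trans; prep; swap; ↭⇒↭ₛ)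
open import Data.List.Relation.Binary.Permutation.Propositional.Properties using (∈-resp-↭; ↭-length; map⁺)
open import Data.List.Relation.Binary.Permutation.Setoid.Properties using (Unique-resp-↭)
open import Data.List.Relation.Unary.All as All using (All; []; _∷_)
open import Data.List.Relation.Unary.All.Properties using () renaming (all⁺ to all⇒All)
open import Data.List.Relation.Unary.AllPairs using ([]; _∷_)
open import Data.List.Relation.Unary.Any as Any using (Any; here; there)
open import Data.List.Relation.Unary.Any.Properties using (lookup-index) renaming (any⁺ to Any⇒any; any⁻ to any⇒Any)
open import Data.List.Relation.Unary.Unique.Propositional using (Unique)
open import Data.List.Relation.Unary.Unique.Propositional.Properties using (Unique[x∷xs]⇒x∉xs; ++⁺; allFin⁺; filter⁺) renaming (map⁺ to Unique-map⁺)
open import Data.Nat using (ℕ; zero; suc; _+_; _∸_; _^_; _≤_; _<_; _≤?_; _<ᵇ_; _≡ᵇ_; s≤s)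
open import Data.Nat.ListAction using (sum)
open import Data.Nat.ListAction.Properties using (sum-↭)
import Data.Nat.Properties as ℕ
open import Data.Product using (Σ-syntax; ∃-syntax; _×_; _,_; proj₁; proj₂)
import Data.Product as Product
open import Data.Sum using (_⊎_; inj₁; inj₂)
import Data.Vec as Vec
open import Data.Vec.Properties using ([]=⇒lookup; lookup⇒[]=)
open import Function using (_∘_; id)
open import Function.Bundles using (_↔_; Equivalence; Inverse; mk↔ₛ′; mk⇔)
open import Relation.Binary.Definitions using (DecidableEquality)
open import Relation.Binary.PropositionalEquality using (_≡_; _≢_; refl; sym; trans; cong; cong₂; subst; setoid)
open import Relation.Nullary using (¬_; Dec; yes; no; does; contradiction)
open import Relation.Nullary.Decidable using (toWitness; _→-dec_)

-- The search is proved complete by walking a given geometry `G` through it. A node stands for a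
-- duplicate-free list of placed points of `G` together with the traces on it of all lines with two
-- placed points; two points determine a line, so such traces name their lines unambiguously.
-- Placing the green points before the red ones keeps the branching small: a line joining a new red
-- point to a placed red one contains a green point, so it already has a row, and every newly
-- created row joins the new point to a green one. Isomorphism tests are trusted only when positive.
-- They then supply a column permutation, the placed points are reordered by it, and the walk goes
-- on at the representative; a missed isomorphism merely enlarges the search. A node without
-- monochromatic lines may be all of `G`, so it has to be recognised there and also extended
-- further.

private variable
  A B C : Set

-- A row is the characteristic vector of a set of points relative to a list of
-- points; a table is used as a set of rows, regardless of order and repetition.
Row : Set
Row = List Bool

Table : Set
Table = List Row

-- Operations on incidence rows

meets : Row → Row → Bool
meets (true ∷ R) (b ∷ S) = b ∨ meets R S
meets (false ∷ R) (_ ∷ S) = meets R S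
meets _ _ = false

size : Row → ℕ
size [] = 0
size (true ∷ R) = suc (size R)
size (false ∷ R) = size R

same : Row → Row → Bool
same [] [] = true
same (true ∷ R) (b ∷ S) = b ∧ same R S
same (false ∷ R) (b ∷ S) = not b ∧ same R S
same _ _ = false

union : Row → Row → Row
union (b ∷ R) (c ∷ S) = (b ∨ c) ∷ union R S
union _ _ = []

-- The search knows points only as columns; this list of unit rows is its way of running over the
-- points outside a set.
singletons∉ : Row → List Row
singletons∉ [] = []
singletons∉ (true ∷ R) = map (false ∷_) (singletons∉ R)
singletons∉ (false ∷ R) = (true ∷ map (λ _ → false) R) ∷ map (false ∷_) (singletons∉ R)

-- Boolean tests and the propositions they decide

T⇒≡true : ∀ {b} → T b → b ≡ true
T⇒≡true = Equivalence.to T-≡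

¬T⇒≡false : ∀ {b} → ¬ T b → b ≡ false
¬T⇒≡false {true} ¬t = ⊥-elim (¬t _)
¬T⇒≡false {false} _ = refl

¬T⇒T-not : ∀ {b} → ¬ T b → T (not b)
¬T⇒T-not {true} ¬t = ¬t _
¬T⇒T-not {false} _ = _

T-not⇒¬T : ∀ {b} → T (not b) → ¬ T b
T-not⇒¬T {true} ()

T-∧⁻ : ∀ {b c} → T (b ∧ c) → T b × T c
T-∧⁻ = Equivalence.to T-∧

T-∧⁺ : ∀ {b c} → T b → T c → T (b ∧ c)
T-∧⁺ p q = Equivalence.from T-∧ (p , q)

T-∨⁻ : ∀ {b c} → T (b ∨ c) → T b ⊎ T c
T-∨⁻ = Equivalence.to T-∨

T-∨⁺ˡ : ∀ {b c} → T b → T (b ∨ c)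
T-∨⁺ˡ = Equivalence.from T-∨ ∘ inj₁

T-∨⁺ʳ : ∀ {b c} → T c → T (b ∨ c)
T-∨⁺ʳ {b} = Equivalence.from (T-∨ {b}) ∘ inj₂

any⁺ : ∀ (p : A → Bool) {x xs} → x ∈ xs → T (p x) → T (any p xs)
any⁺ p x∈ px = Any⇒any p (Any.map (λ { refl → px }) x∈)

any⁻ : ∀ (p : A → Bool) xs → T (any p xs) → ∃[ x ] x ∈ xs × T (p x)
any⁻ p xs = find ∘ any⇒Any p xs

all⁻ : ∀ (p : A → Bool) {x xs} → T (all p xs) → x ∈ xs → T (p x)
all⁻ p {xs = xs} t = All.lookup (all⇒All p xs t)

all≡true⁻ : ∀ (p : A → Bool) xs {x} → all p xs ≡ true → x ∈ xs → T (p x)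
all≡true⁻ p xs eq = all⁻ p {xs = xs} (subst T (sym eq) _)

∈-filterᵇ⁺ : ∀ (p : A → Bool) {x xs} → x ∈ xs → T (p x) → x ∈ filterᵇ p xs
∈-filterᵇ⁺ p = ∈-filter⁺ (T? ∘ p)

∈-filterᵇ⁻ : ∀ (p : A → Bool) {x} xs → x ∈ filterᵇ p xs → x ∈ xs × T (p x)
∈-filterᵇ⁻ p xs = ∈-filter⁻ (T? ∘ p) {xs = xs}

meets⁺ : ∀ (f g : A → Bool) {x xs} → x ∈ xs → T (f x) → T (g x) → T (meets (map f xs) (map g xs))
meets⁺ f g {x} (here refl) fx gx with f x
... | true = T-∨⁺ˡ gx
meets⁺ f g {xs = y ∷ _} (there x∈) fx gx with f y
... | true  = T-∨⁺ʳ {g y} (meets⁺ f g x∈ fx gx)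
... | false = meets⁺ f g x∈ fx gx

meets⁻ : ∀ (f g : A → Bool) xs → T (meets (map f xs) (map g xs)) → ∃[ x ] x ∈ xs × T (f x) × T (g x)
meets⁻ f g (y ∷ xs) t with f y in fy
... | false = let x , x∈ , p = meets⁻ f g xs t in x , there x∈ , p
... | true with T-∨⁻ {g y} t
...   | inj₁ gy = y , here refl , subst T (sym fy) _ , gy
...   | inj₂ t′ = let x , x∈ , p = meets⁻ f g xs t′ in x , there x∈ , p

same⇒≡ : ∀ R S → T (same R S) → R ≡ S
same⇒≡ [] [] _ = refl
same⇒≡ (true ∷ R) (true ∷ S) t = cong (true ∷_) (same⇒≡ R S t)
same⇒≡ (false ∷ R) (false ∷ S) t = cong (false ∷_) (same⇒≡ R S t)

same-refl : ∀ R → T (same R R)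
same-refl [] = _
same-refl (true ∷ R) = same-refl R
same-refl (false ∷ R) = same-refl R

union-map : ∀ (f g : A → Bool) xs → union (map f xs) (map g xs) ≡ map (λ x → f x ∨ g x) xs
union-map f g [] = refl
union-map f g (x ∷ xs) = cong (_ ∷_) (union-map f g xs)

map-injective-∈ : ∀ {f g : A → B} {x xs} → map f xs ≡ map g xs → x ∈ xs → f x ≡ g x
map-injective-∈ {xs = _ ∷ _} eq (here refl) = ∷-injectiveˡ eq
map-injective-∈ {xs = _ ∷ _} eq (there x∈) = map-injective-∈ (∷-injectiveʳ eq) x∈

map-cong-∈ : ∀ {f g : A → B} xs → (∀ x → x ∈ xs → f x ≡ g x) → map f xs ≡ map g xs
map-cong-∈ xs eq = map-cong-local (All.tabulate (λ {x} → eq x))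

module _ {A : Set} (_≟_ : DecidableEquality A) where

  point : A → A → Bool
  point x y = does (x ≟ y)

  point-refl : ∀ x → T (point x x)
  point-refl x with x ≟ x
  ... | yes _ = _
  ... | no x≢x = x≢x refl

  point⇒≡ : ∀ {x y} → T (point x y) → x ≡ y
  point⇒≡ {x} {y} t with yes eq ← x ≟ y = eq

  private
    point-∉ : ∀ {x} xs → x ∉ xs → map (point x) xs ≡ map (λ _ → false) xs
    point-∉ xs x∉ = map-cong-∈ xs (λ y y∈ → ¬T⇒≡false (λ t → x∉ (subst (_∈ xs) (sym (point⇒≡ t)) y∈)))

    head∉ : ∀ {x : A} {xs} → Unique (x ∷ xs) → x ∉ xs
    head∉ = Unique[x∷xs]⇒x∉xs

    cons-true : ∀ {x xs} → x ∉ xs → true ∷ map (λ _ → false) xs ≡ map (point x) (x ∷ xs)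
    cons-true {x} {xs} x∉ = cong₂ _∷_ (sym (T⇒≡true (point-refl x))) (sym (point-∉ xs x∉))

    cons-false : ∀ {x y xs} → x ∈ xs → y ∉ xs → false ∷ map (point x) xs ≡ map (point x) (y ∷ xs)
    cons-false {x} {xs = xs} x∈ y∉ = cong (_∷ map (point x) xs) (sym (¬T⇒≡false (λ t → y∉ (subst (_∈ _) (point⇒≡ t) x∈))))

  -- `Unique` matters here: in a list with repetitions the row of a point would have several entries
  -- `true`, whereas a row produced here has one.
  singletons∉⁻ : ∀ (f : A → Bool) {xs R} → Unique xs → R ∈ singletons∉ (map f xs) →
                 ∃[ x ] x ∈ xs × ¬ T (f x) × R ≡ map (point x) xs
  singletons∉⁻ f {y ∷ xs} u R∈ with f y in fy
  singletons∉⁻ f {y ∷ xs} (y# ∷ u) R∈ | true with ∈-map⁻ (false ∷_) R∈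
  ... | S , S∈ , refl with singletons∉⁻ f u S∈
  ...   | x , x∈ , ¬fx , refl = x , there x∈ , ¬fx , cons-false x∈ (head∉ (y# ∷ u))
  singletons∉⁻ f {y ∷ xs} u (here refl) | false =
    y , here refl , subst T fy , trans (cong (true ∷_) (sym (map-∘ xs))) (cons-true (head∉ u))
  singletons∉⁻ f {y ∷ xs} (y# ∷ u) (there R∈) | false with ∈-map⁻ (false ∷_) R∈
  ... | S , S∈ , refl with singletons∉⁻ f u S∈
  ...   | x , x∈ , ¬fx , refl = x , there x∈ , ¬fx , cons-false x∈ (head∉ (y# ∷ u))

  singletons∉⁺ : ∀ (f : A → Bool) {xs x} → Unique xs → x ∈ xs → ¬ T (f x) →
                 map (point x) xs ∈ singletons∉ (map f xs)
  singletons∉⁺ f {y ∷ xs} u x∈ ¬fx with f y in fy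
  singletons∉⁺ f {y ∷ xs} u (here refl) ¬fx | true = contradiction (subst T (sym fy) _) ¬fx
  singletons∉⁺ f {y ∷ xs} (y# ∷ u) (there x∈) ¬fx | true =
    subst (_∈ map (false ∷_) (singletons∉ (map f xs))) (cons-false x∈ (head∉ (y# ∷ u)))
      (∈-map⁺ (false ∷_) (singletons∉⁺ f u x∈ ¬fx))
  singletons∉⁺ f {y ∷ xs} u (here refl) ¬fx | false =
    here (sym (trans (cong (true ∷_) (sym (map-∘ xs))) (cons-true (head∉ u))))
  singletons∉⁺ f {y ∷ xs} (y# ∷ u) (there x∈) ¬fx | false =
    there (subst (_∈ map (false ∷_) (singletons∉ (map f xs))) (cons-false x∈ (head∉ (y# ∷ u)))
      (∈-map⁺ (false ∷_) (singletons∉⁺ f u x∈ ¬fx)))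

lookup-injective : ∀ {xs : List A} → Unique xs → ∀ i j → lookup xs i ≡ lookup xs j → i ≡ j
lookup-injective (_ ∷ _) zero zero _ = refl
lookup-injective (x# ∷ _) zero (suc j) eq = contradiction eq (All.lookup x# (∈-lookup j))
lookup-injective (x# ∷ _) (suc i) zero eq = contradiction (sym eq) (All.lookup x# (∈-lookup i))
lookup-injective (_ ∷ u) (suc i) (suc j) eq = cong suc (lookup-injective u i j eq)

unique-length : ∀ {n} {xs : List (Fin n)} → Unique xs → length xs ≤ n
unique-length u = Fin.injective⇒≤ (lookup-injective u _ _)

-- The lines of a table through a point to be added: those decided to pass
-- through it, the undecided ones and those decided to miss it.
record Choice : Set where
  constructor ⟨_,_,_⟩
  field
    on undecided off : Table

-- Two lines through the new point share no other point. Once `R` passes through it, every other row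
-- meeting `R` is therefore off, and further copies of `R` are dropped.
choose : Row → Choice → Choice
choose R ⟨ on , und , off ⟩ =
  ⟨ R ∷ on , filterᵇ (λ S → not (meets R S)) und , filterᵇ (λ S → meets R S ∧ not (same R S)) und ++ off ⟩

-- Decides the line joining the new point to the point with row e.
expand : Row → Choice → List Choice
expand e ⟨ on , und , off ⟩ =
  if any (meets e) on
  then ⟨ on , und , off ⟩ ∷ []
  else map (λ R → choose R ⟨ on , und , off ⟩) (filterᵇ (meets e) und)

expands : List Row → List Choice → List Choice
expands [] cs = cs
expands (e ∷ es) cs = expands es (concatMap (expand e) cs)

-- A row meeting an accepted one is settled: it repeats an accepted row or misses the new point. A
-- row disjoint from all accepted ones may or may not pass through the point, and both cases are
-- returned.
finish : Table → Table → Table → List (Table × Table)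
finish on [] off = (on , off) ∷ []
finish on (R ∷ und) off =
  if any (meets R) on
  then (if any (same R) on then finish on und off else finish on und (R ∷ off))
  else finish on und (R ∷ off) ++ finish (R ∷ on) und off

-- A point on none of the accepted lines is joined to the new point by a line with no other placed
-- point, which gives a new two-point row. The argument `∅` is the all-`false` row, which fixes the
-- width of the union.
child : Row → Table × Table → Table
child ∅ (on , off) = map (true ∷_) on ++ map (false ∷_) off ++ map (true ∷_) (singletons∉ (foldr union ∅ on))

-- Tables presenting the lines on the placed points, and adding a point

incident : (G : Geom) → Fin (nlines G) → Fin (pts G) → Bool
incident G l = Vec.lookup (line G l)

module Traces (G : Geom) (fls : IsFLS G) where

  private
    Point = Fin (pts G)
    Line  = Fin (nlines G)
    inc   = incident G

  ∈⇒inc : ∀ {x l} → x Subset.∈ line G l → T (inc l x)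
  ∈⇒inc x∈ = subst T (sym ([]=⇒lookup x∈)) _

  inc⇒∈ : ∀ {x l} → T (inc l x) → x Subset.∈ line G l
  inc⇒∈ {x} {l} t = lookup⇒[]= x (line G l) (T⇒≡true t)

  join : ∀ {x y} → x ≢ y → ∃[ l ] T (inc l x) × T (inc l y)
  join x≢y = let l , (x∈ , y∈) , _ = IsFLS.unique fls _ _ x≢y in l , ∈⇒inc x∈ , ∈⇒inc y∈

  join-unique : ∀ {x y l m} → x ≢ y → T (inc l x) → T (inc l y) → T (inc m x) → T (inc m y) → l ≡ m
  join-unique x≢y lx ly mx my =
    let _ , _ , uniq = IsFLS.unique fls _ _ x≢y
    in trans (uniq _ (inc⇒∈ lx) (inc⇒∈ ly)) (sym (uniq _ (inc⇒∈ mx) (inc⇒∈ my)))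

  trace : Line → List Point → Row
  trace l = map (inc l)

  trace-inc : ∀ {l m ps x} → trace l ps ≡ trace m ps → x ∈ ps → T (inc l x) → T (inc m x)
  trace-inc eq x∈ = subst T (map-injective-∈ eq x∈)

  -- A line enters a table once two of its points are placed, since from then on its trace
  -- determines it. With fewer points different lines may have equal traces.
  record Secant (ps : List Point) (l : Line) : Set where
    constructor secant
    field
      {p₁ p₂} : Point
      p₁≢p₂ : p₁ ≢ p₂
      p₁∈ : p₁ ∈ ps
      p₂∈ : p₂ ∈ ps
      p₁-on : T (inc l p₁)
      p₂-on : T (inc l p₂)

  trace-injective : ∀ {l m ps} → Secant ps l → trace l ps ≡ trace m ps → l ≡ m
  trace-injective (secant x≢y x∈ y∈ lx ly) eq =
    join-unique x≢y lx ly (trace-inc eq x∈ lx) (trace-inc eq y∈ ly)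

  record Presents (ps : List Point) (t : Table) : Set where
    constructor presents
    field
      sound    : ∀ {R} → R ∈ t → ∃[ l ] Secant ps l × R ≡ trace l ps
      complete : ∀ {l} → Secant ps l → trace l ps ∈ t

  Through : List Point → Point → Row → Set
  Through ps p R = ∃[ l ] T (inc l p) × R ≡ trace l ps

  through-unique : ∀ {ps p q R S} → p ∉ ps → Through ps p R → Through ps p S →
                   T (meets (map (point _≟F_ q) ps) R) → T (meets (map (point _≟F_ q) ps) S) → R ≡ S
  through-unique {ps} {q = q} p∉ (l , lp , refl) (m , mp , refl) tR tS
    with meets⁻ (point _≟F_ q) (inc l) ps tR | meets⁻ (point _≟F_ q) (inc m) ps tS
  ... | x , x∈ , qx , lx | y , y∈ , qy , my
    with refl ← point⇒≡ _≟F_ {q} {x} qx | refl ← point⇒≡ _≟F_ {q} {y} qy =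
    cong (λ k → trace k ps) (join-unique (λ { refl → p∉ x∈ }) lp lx mp my)

  through-meets : ∀ {ps p R S} → p ∉ ps → Through ps p R → Through ps p S → T (meets R S) → R ≡ S
  through-meets {ps} p∉ (l , lp , refl) (m , mp , refl) t with meets⁻ (inc l) (inc m) ps t
  ... | x , x∈ , lx , mx = cong (λ k → trace k ps) (join-unique (λ { refl → p∉ x∈ }) lp lx mp mx)

  -- The decisions recorded in a choice are correct for the point p.
  record Follows (ps : List Point) (t : Table) (p : Point) (c : Choice) : Set where
    open Choice c
    field
      cover   : ∀ {R} → R ∈ t → R ∈ on ⊎ R ∈ undecided ⊎ R ∈ off
      on⊆     : ∀ {R} → R ∈ on → R ∈ t
      und⊆    : ∀ {R} → R ∈ undecided → R ∈ t
      off⊆    : ∀ {R} → R ∈ off → R ∈ t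
      through : ∀ {R} → R ∈ on → Through ps p R
      misses  : ∀ {R} → R ∈ off → ¬ Through ps p R

  module _ {ps : List Point} {t : Table} {p : Point} (p∉ : p ∉ ps) (pres : Presents ps t) where
    open Presents pres
    open Follows

    -- The row is the trace of a secant, and any line with the same trace equals that secant, so
    -- testing this single line decides the question.
    through? : ∀ {R} → R ∈ t → Dec (Through ps p R)
    through? R∈ with sound R∈
    ... | l , sec , refl with T? (inc l p)
    ...   | yes lp = yes (l , lp , refl)
    ...   | no ¬lp = no λ { (m , mp , eq) → ¬lp (subst (λ k → T (inc k p)) (sym (trace-injective sec eq)) mp) }

    nothing-decided : Follows ps t p ⟨ [] , t , [] ⟩
    nothing-decided = record
      { cover = inj₂ ∘ inj₁ ; on⊆ = λ () ; und⊆ = id ; off⊆ = λ () ; through = λ () ; misses = λ () }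

    choose-follows : ∀ {R c} → Follows ps t p c → R ∈ Choice.undecided c → Through ps p R →
                     Follows ps t p (choose R c)
    choose-follows {R} {⟨ on , und , off ⟩} fol R∈ thr = record
      { cover = cov ; on⊆ = λ { (here refl) → und⊆ fol R∈ ; (there S∈) → on⊆ fol S∈ }
      ; und⊆ = und⊆ fol ∘ proj₁ ∘ ∈-filterᵇ⁻ keep und
      ; off⊆ = off′ ; through = λ { (here refl) → thr ; (there S∈) → through fol S∈ }
      ; misses = mis }
      where
      keep drop : Row → Bool
      keep S = not (meets R S)
      drop S = meets R S ∧ not (same R S)
      cov : ∀ {S} → S ∈ t → S ∈ R ∷ on ⊎ S ∈ filterᵇ keep und ⊎ S ∈ filterᵇ drop und ++ off
      cov {S} S∈ with cover fol S∈
      ... | inj₁ S∈on = inj₁ (there S∈on)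
      ... | inj₂ (inj₂ S∈off) = inj₂ (inj₂ (∈-++⁺ʳ _ S∈off))
      ... | inj₂ (inj₁ S∈und) with T? (meets R S)
      ...   | no ¬mt = inj₂ (inj₁ (∈-filterᵇ⁺ keep S∈und (¬T⇒T-not ¬mt)))
      ...   | yes mt with T? (same R S)
      ...     | yes R=S = inj₁ (here (sym (same⇒≡ R S R=S)))
      ...     | no R≠S = inj₂ (inj₂ (∈-++⁺ˡ (∈-filterᵇ⁺ drop S∈und (T-∧⁺ mt (¬T⇒T-not R≠S)))))
      off′ : ∀ {S} → S ∈ filterᵇ drop und ++ off → S ∈ t
      off′ S∈ with ∈-++⁻ (filterᵇ drop und) S∈
      ... | inj₁ S∈′ = und⊆ fol (proj₁ (∈-filterᵇ⁻ drop und S∈′))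
      ... | inj₂ S∈′ = off⊆ fol S∈′
      mis : ∀ {S} → S ∈ filterᵇ drop und ++ off → ¬ Through ps p S
      mis {S} S∈ thr′ with ∈-++⁻ (filterᵇ drop und) S∈
      ... | inj₂ S∈′ = misses fol S∈′ thr′
      ... | inj₁ S∈′ with T-∧⁻ {meets R S} (proj₂ (∈-filterᵇ⁻ drop und S∈′))
      ...   | mt , R≠S with through-meets p∉ thr thr′ mt
      ...     | refl = T-not⇒¬T R≠S (same-refl R)

    -- If no accepted row meets `e`, then `R` is not accepted; since it passes through `p` it is not
    -- rejected either, so it is among the undecided rows offered.
    expand-follows : ∀ {e c R} → Follows ps t p c → R ∈ t → Through ps p R → T (meets e R) →
                     ∃[ c′ ] c′ ∈ expand e c × Follows ps t p c′
    expand-follows {e} {c@(⟨ on , und , off ⟩)} {R} fol R∈ thr eR with any (meets e) on in eq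
    ... | true = c , here refl , fol
    ... | false with cover fol R∈
    ...   | inj₁ R∈on = contradiction (any⁺ (meets e) R∈on eR) (subst T eq)
    ...   | inj₂ (inj₂ R∈off) = contradiction thr (misses fol R∈off)
    ...   | inj₂ (inj₁ R∈und) =
      choose R c , ∈-map⁺ (λ S → choose S c) (∈-filterᵇ⁺ (meets e) R∈und eR) , choose-follows fol R∈und thr

    expands-follows : ∀ {es cs c} → c ∈ cs → Follows ps t p c →
                      (∀ {e} → e ∈ es → ∃[ R ] R ∈ t × Through ps p R × T (meets e R)) →
                      ∃[ c′ ] c′ ∈ expands es cs × Follows ps t p c′
    expands-follows {[]} c∈ fol _ = _ , c∈ , fol
    expands-follows {e ∷ es} c∈ fol joined with joined (here refl)
    ... | R , R∈ , thr , eR with expand-follows {e} fol R∈ thr eR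
    ...   | c′ , c′∈ , fol′ =
      expands-follows {es} (∈-concatMap⁺ (expand e) (Any.map (λ { refl → c′∈ }) c∈)) fol′ (joined ∘ there)

    private
      forget : ∀ {on und off R} → Follows ps t p ⟨ on , R ∷ und , off ⟩ → R ∈ on → Follows ps t p ⟨ on , und , off ⟩
      forget {on} {und} {off} {R} fol R∈ = record
        { cover = λ S∈ → cov (cover fol S∈) ; on⊆ = on⊆ fol ; und⊆ = und⊆ fol ∘ there
        ; off⊆ = off⊆ fol ; through = through fol ; misses = misses fol }
        where
        cov : ∀ {S} → S ∈ on ⊎ S ∈ R ∷ und ⊎ S ∈ off → S ∈ on ⊎ S ∈ und ⊎ S ∈ off
        cov (inj₁ S∈) = inj₁ S∈
        cov (inj₂ (inj₁ (here refl))) = inj₁ R∈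
        cov (inj₂ (inj₁ (there S∈))) = inj₂ (inj₁ S∈)
        cov (inj₂ (inj₂ S∈)) = inj₂ (inj₂ S∈)

      reject : ∀ {on und off R} → Follows ps t p ⟨ on , R ∷ und , off ⟩ → ¬ Through ps p R →
               Follows ps t p ⟨ on , und , R ∷ off ⟩
      reject {on} {und} {off} {R} fol ¬thr = record
        { cover = λ S∈ → cov (cover fol S∈) ; on⊆ = on⊆ fol ; und⊆ = und⊆ fol ∘ there
        ; off⊆ = λ { (here refl) → und⊆ fol (here refl) ; (there S∈) → off⊆ fol S∈ }
        ; through = through fol ; misses = λ { (here refl) → ¬thr ; (there S∈) → misses fol S∈ } }
        where
        cov : ∀ {S} → S ∈ on ⊎ S ∈ R ∷ und ⊎ S ∈ off → S ∈ on ⊎ S ∈ und ⊎ S ∈ R ∷ off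
        cov (inj₁ S∈) = inj₁ S∈
        cov (inj₂ (inj₁ (here refl))) = inj₂ (inj₂ (here refl))
        cov (inj₂ (inj₁ (there S∈))) = inj₂ (inj₁ S∈)
        cov (inj₂ (inj₂ S∈)) = inj₂ (inj₂ (there S∈))

      accept : ∀ {on und off R} → Follows ps t p ⟨ on , R ∷ und , off ⟩ → Through ps p R →
               Follows ps t p ⟨ R ∷ on , und , off ⟩
      accept {on} {und} {off} {R} fol thr = record
        { cover = λ S∈ → cov (cover fol S∈)
        ; on⊆ = λ { (here refl) → und⊆ fol (here refl) ; (there S∈) → on⊆ fol S∈ }
        ; und⊆ = und⊆ fol ∘ there ; off⊆ = off⊆ fol
        ; through = λ { (here refl) → thr ; (there S∈) → through fol S∈ } ; misses = misses fol }
        where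
        cov : ∀ {S} → S ∈ on ⊎ S ∈ R ∷ und ⊎ S ∈ off → S ∈ R ∷ on ⊎ S ∈ und ⊎ S ∈ off
        cov (inj₁ S∈) = inj₁ (there S∈)
        cov (inj₂ (inj₁ (here refl))) = inj₁ (here refl)
        cov (inj₂ (inj₁ (there S∈))) = inj₂ (inj₁ S∈)
        cov (inj₂ (inj₂ S∈)) = inj₂ (inj₂ S∈)

    finish-follows : ∀ {on und off} → Follows ps t p ⟨ on , und , off ⟩ →
                     ∃[ f ] f ∈ finish on und off × Follows ps t p ⟨ proj₁ f , [] , proj₂ f ⟩
    finish-follows {on} {[]} {off} fol = (on , off) , here refl , fol
    finish-follows {on} {R ∷ und} {off} fol with any (meets R) on in met
    ... | true with any (same R) on in dup
    ...   | true with any⁻ (same R) on (subst T (sym dup) _)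
    ...     | S , S∈ , R=S = finish-follows (forget fol (subst (_∈ on) (sym (same⇒≡ R S R=S)) S∈))
    finish-follows {on} {R ∷ und} {off} fol | true | false = finish-follows (reject fol R-misses)
      where
      R-misses : ¬ Through ps p R
      R-misses thr with any⁻ (meets R) on (subst T (sym met) _)
      ... | S , S∈ , RS with through-meets p∉ thr (through fol S∈) RS
      ...   | refl = subst T dup (any⁺ (same R) S∈ (same-refl R))
    finish-follows {on} {R ∷ und} {off} fol | false with through? (und⊆ fol (here refl))
    ... | yes thr = let f , f∈ , fol′ = finish-follows (accept fol thr) in f , ∈-++⁺ʳ _ f∈ , fol′
    ... | no ¬thr = let f , f∈ , fol′ = finish-follows (reject fol ¬thr) in f , ∈-++⁺ˡ f∈ , fol′

    private
      lines-on : ∀ on → (∀ {R} → R ∈ on → Through ps p R) →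
                 ∃[ ls ] on ≡ map (λ l → trace l ps) ls × (∀ {l} → l ∈ ls → T (inc l p))
      lines-on [] _ = [] , refl , λ ()
      lines-on (R ∷ on) thr with thr (here refl) | lines-on on (thr ∘ there)
      ... | l , lp , refl | ls , refl , lsp = l ∷ ls , refl , λ { (here refl) → lp ; (there l∈) → lsp l∈ }

      union-traces : ∀ ls → foldr union (map (λ _ → false) ps) (map (λ l → trace l ps) ls)
                            ≡ map (λ x → any (λ l → inc l x) ls) ps
      union-traces [] = refl
      union-traces (l ∷ ls) = trans (cong (union (trace l ps)) (union-traces ls)) (union-map (inc l) _ ps)

    -- A line through `p` and a placed point either has two placed points, and then its row is in
    -- `on`, or it has just one, and then it is one of the new two-point lines. The other secants
    -- miss `p` and are the rows in `off`.
    child-presents : ∀ {f} → Unique ps → Follows ps t p ⟨ proj₁ f , [] , proj₂ f ⟩ →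
                     Presents (p ∷ ps) (child (map (λ _ → false) ps) f)
    child-presents {on , off} uniq fol with lines-on on (through fol)
    -- With `on` written as the traces of lines `ls` through `p`, the union row is the set of points
    -- joined to `p` by a line of `ls`.
    ... | ls , refl , ls-p = subst (λ U → Presents (p ∷ ps) (parts U)) (sym (union-traces ls)) (presents snd cmp)
      where
      parts : Row → Table
      parts U = map (true ∷_) on ++ map (false ∷_) off ++ map (true ∷_) (singletons∉ U)

      joined : Point → Bool
      joined x = any (λ l → inc l x) ls

      through⇒∈on : ∀ {R} → R ∈ t → Through ps p R → R ∈ on
      through⇒∈on R∈ thr with cover fol R∈
      ... | inj₁ R∈on = R∈on
      ... | inj₂ (inj₂ R∈off) = contradiction thr (misses fol R∈off)

      trace-joined : ∀ {l x} → trace l ps ∈ on → x ∈ ps → T (inc l x) → T (joined x)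
      trace-joined tr∈ x∈ lx with ∈-map⁻ (λ l → trace l ps) tr∈
      ... | m , m∈ , eq = any⁺ (λ l → inc l _) m∈ (trace-inc eq x∈ lx)

      -- A second placed point on the line would make it a secant through `p`, hence accepted, and
      -- `x` would be joined.
      trace-new : ∀ {l x} → x ∈ ps → ¬ T (joined x) → T (inc l p) → T (inc l x) →
                  trace l ps ≡ map (point _≟F_ x) ps
      trace-new {l} {x} x∈ ¬jx lp lx = map-cong-∈ ps eq
        where
        eq : ∀ y → y ∈ ps → inc l y ≡ point _≟F_ x y
        eq y y∈ with x ≟F y
        ... | yes refl = T⇒≡true lx
        ... | no x≢y = ¬T⇒≡false λ ly →
          ¬jx (trace-joined (through⇒∈on (complete (secant x≢y x∈ y∈ lx ly)) (l , lp , refl)) x∈ lx)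

      weaken : ∀ {l} → Secant ps l → Secant (p ∷ ps) l
      weaken (secant x≢y x∈ y∈ lx ly) = secant x≢y (there x∈) (there y∈) lx ly

      snd : ∀ {R} → R ∈ parts (map joined ps) → ∃[ l ] Secant (p ∷ ps) l × R ≡ trace l (p ∷ ps)
      snd R∈ with ∈-++⁻ (map (true ∷_) on) R∈
      ... | inj₁ R∈on with ∈-map⁻ (true ∷_) R∈on
      ...   | S , S∈ , refl with sound (on⊆ fol S∈) | through fol S∈
      ...     | l , sec , eq | m , mp , eq′ with trace-injective sec (trans (sym eq) eq′)
      ...       | refl = l , weaken sec , cong₂ _∷_ (sym (T⇒≡true mp)) eq
      snd R∈ | inj₂ R∈′ with ∈-++⁻ (map (false ∷_) off) R∈′
      ... | inj₁ R∈off with ∈-map⁻ (false ∷_) R∈off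
      ...   | S , S∈ , refl with sound (off⊆ fol S∈)
      ...     | l , sec , eq = l , weaken sec , cong₂ _∷_ (sym (¬T⇒≡false λ lp → misses fol S∈ (l , lp , eq))) eq
      snd R∈ | inj₂ R∈′ | inj₂ R∈new with ∈-map⁻ (true ∷_) R∈new
      ... | S , S∈ , refl with singletons∉⁻ _≟F_ joined uniq S∈
      ...   | x , x∈ , ¬jx , refl with join {p} {x} (λ { refl → p∉ x∈ })
      ...     | l , lp , lx = l , secant (λ { refl → p∉ x∈ }) (here refl) (there x∈) lp lx
                            , cong₂ _∷_ (sym (T⇒≡true lp)) (sym (trace-new x∈ ¬jx lp lx))

      joined-∈ : ∀ {l x} → x ∈ ps → T (inc l p) → T (inc l x) → trace l (p ∷ ps) ∈ parts (map joined ps)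
      joined-∈ {l} {x} x∈ lp lx rewrite T⇒≡true lp with T? (joined x)
      ... | no ¬jx = ∈-++⁺ʳ (map (true ∷_) on) (∈-++⁺ʳ (map (false ∷_) off) (∈-map⁺ (true ∷_)
                       (subst (_∈ singletons∉ (map joined ps)) (sym (trace-new x∈ ¬jx lp lx))
                         (singletons∉⁺ _≟F_ joined uniq x∈ ¬jx))))
      ... | yes jx with any⁻ (λ m → inc m x) ls jx
      ...   | m , m∈ , mx with join-unique (λ { refl → p∉ x∈ }) lp lx (ls-p m∈) mx
      ...     | refl = ∈-++⁺ˡ (∈-map⁺ (true ∷_) (∈-map⁺ (λ k → trace k ps) m∈))

      on-p : ∀ {l} → Secant ps l → trace l ps ∈ on → T (inc l p)
      on-p sec R∈ with through fol R∈
      ... | m , mp , eq = subst (λ k → T (inc k p)) (sym (trace-injective sec eq)) mp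

      cmp : ∀ {l} → Secant (p ∷ ps) l → trace l (p ∷ ps) ∈ parts (map joined ps)
      cmp (secant x≢y (here refl) (here refl) lx ly) = contradiction refl x≢y
      cmp (secant x≢y (here refl) (there y∈) lx ly) = joined-∈ y∈ lx ly
      cmp (secant x≢y (there x∈) (here refl) lx ly) = joined-∈ x∈ ly lx
      cmp {l} (secant x≢y (there x∈) (there y∈) lx ly) with cover fol (complete (secant x≢y x∈ y∈ lx ly))
      ... | inj₁ R∈on rewrite T⇒≡true (on-p (secant x≢y x∈ y∈ lx ly) R∈on) = ∈-++⁺ˡ (∈-map⁺ (true ∷_) R∈on)
      ... | inj₂ (inj₂ R∈off) rewrite ¬T⇒≡false {inc l p} (λ lp → misses fol R∈off (l , lp , refl)) =
        ∈-++⁺ʳ (map (true ∷_) on) (∈-++⁺ˡ (∈-map⁺ (false ∷_) R∈off))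

-- Column permutations and the isomorphism test

pick : ℕ → A → List A → A × List A
pick zero x xs = x , xs
pick (suc k) x [] = x , []
pick (suc k) x (y ∷ ys) = Product.map₂ (x ∷_) (pick k y ys)

-- A list of numbers encodes a permutation by successive picks.  Every list does,
-- since positions out of range pick the last element.
permute : List ℕ → List A → List A
permute [] xs = xs
permute (k ∷ ks) [] = []
permute (k ∷ ks) (x ∷ xs) = proj₁ (pick k x xs) ∷ permute ks (proj₂ (pick k x xs))

pickBit : ℕ → Row → Bool × Row
pickBit k [] = false , []
pickBit k (b ∷ R) = pick k b R

agree : Bool → Bool → Bool
agree true c = c
agree false c = not c

selectBit : Bool → ℕ → Table → Table
selectBit b k t = map proj₂ (filterᵇ (λ r → agree b (proj₁ r)) (map (pickBit k) t))

Group : Set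
Group = Table × Table

-- The columns of the second table are consumed in order, and `k` is the column of the first table
-- matched with its current column `0`.
splitBy : ℕ → Group → List Group
splitBy k (t , u) = (selectBit true k t , selectBit true 0 u) ∷ (selectBit false k t , selectBit false 0 u) ∷ []

eqLength : Table → Table → Bool
eqLength [] [] = true
eqLength (_ ∷ t) (_ ∷ u) = eqLength t u
eqLength _ _ = false

balanced : Group → Bool
balanced (t , u) = eqLength t u

inhabited : Group → Bool
inhabited (t , u) = not (null t)

-- Backtracking over the columns of the first tables: the rows in one group agree
-- on all columns matched so far, so corresponding groups must have equal lengths.
refine check : ℕ → List Group → Bool
refine zero gs = true
refine (suc m) gs = any (λ k → check m (concatMap (splitBy k) gs)) (upTo (suc m))
check m gs = all balanced gs ∧ refine m (filterᵇ inhabited gs)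

groupBySize : List ℕ → Table → Table → List Group
groupBySize [] t u = (t , u) ∷ []
groupBySize (k ∷ ks) t u =
  (filterᵇ (λ R → size R ≡ᵇ k) t , filterᵇ (λ R → size R ≡ᵇ k) u) ∷
  groupBySize ks (filterᵇ (λ R → not (size R ≡ᵇ k)) t) (filterᵇ (λ R → not (size R ≡ᵇ k)) u)

-- A group consisting of the two colour rows forces the permutation to preserve colours. Grouping
-- the lines by size 2, 3, 4 and the rest prunes the backtracking from the start.
isomorphic : Row × Table → Row × Table → Bool
isomorphic (r , t) (s , u) =
  (length r ≡ᵇ length s) ∧ (size r ≡ᵇ size s) ∧ eqLength t u ∧
  check (length r) ((r ∷ [] , s ∷ []) ∷ groupBySize (2 ∷ 3 ∷ 4 ∷ []) t u) ∧
  all (λ R → length R ≡ᵇ length r) (t ++ u)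

insert : Row → Table → List Table → List Table
insert r t us = if any (λ u → isomorphic (r , t) (r , u)) us then us else t ∷ us

dedupe : Row → List Table → List Table
dedupe r [] = []
dedupe r (t ∷ ts) = insert r t (dedupe r ts)

-- Includes the degenerate space whose points are all on one line.
linearSpaces : ℕ → List Table
linearSpaces zero = [] ∷ []
linearSpaces (suc n) =
  dedupe (replicate (suc n) false)
    (concatMap (λ t → map (child (replicate n false)) (finish [] t [])) (linearSpaces n))

pick-↭ : ∀ k (x : A) xs → proj₁ (pick k x xs) ∷ proj₂ (pick k x xs) ↭ x ∷ xs
pick-↭ zero x xs = ↭-refl
pick-↭ (suc k) x [] = ↭-refl
pick-↭ (suc k) x (y ∷ ys) = ↭-trans (swap _ x ↭-refl) (prep x (pick-↭ k y ys))

permute-↭ : ∀ ks (xs : List A) → permute ks xs ↭ xs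
permute-↭ [] xs = ↭-refl
permute-↭ (k ∷ ks) [] = ↭-refl
permute-↭ (k ∷ ks) (x ∷ xs) = ↭-trans (prep _ (permute-↭ ks _)) (pick-↭ k x xs)

pick-map : ∀ (f : A → B) k x xs → pick k (f x) (map f xs) ≡ Product.map f (map f) (pick k x xs)
pick-map f zero x xs = refl
pick-map f (suc k) x [] = refl
pick-map f (suc k) x (y ∷ ys) rewrite pick-map f k y ys = refl

permute-map : ∀ (f : A → B) ks xs → permute ks (map f xs) ≡ map f (permute ks xs)
permute-map f [] xs = refl
permute-map f (k ∷ ks) [] = refl
permute-map f (k ∷ ks) (x ∷ xs) rewrite pick-map f k x xs = cong (_ ∷_) (permute-map f ks _)

agree-refl : ∀ b → T (agree b b)
agree-refl true = _
agree-refl false = _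

agree⇒≡ : ∀ {b c} → T (agree b c) → b ≡ c
agree⇒≡ {true} {true} _ = refl
agree⇒≡ {false} {false} _ = refl

∈-selectBit⁺ : ∀ {k R t} → R ∈ t → proj₂ (pickBit k R) ∈ selectBit (proj₁ (pickBit k R)) k t
∈-selectBit⁺ {k} {R} R∈ =
  ∈-map⁺ proj₂ (∈-filterᵇ⁺ (λ r → agree (proj₁ (pickBit k R)) (proj₁ r)) (∈-map⁺ (pickBit k) R∈)
                           (agree-refl (proj₁ (pickBit k R))))

∈-selectBit⁻ : ∀ {b k R} t → R ∈ selectBit b k t → ∃[ S ] S ∈ t × pickBit k S ≡ (b , R)
∈-selectBit⁻ {b} {k} t R∈ with ∈-map⁻ proj₂ R∈
... | r , r∈ , refl with ∈-filterᵇ⁻ (λ r → agree b (proj₁ r)) (map (pickBit k) t) r∈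
...   | r∈′ , ag with ∈-map⁻ (pickBit k) r∈′
...     | S , S∈ , refl = S , S∈ , cong (_, _) (sym (agree⇒≡ {b} ag))

pickBit-length : ∀ {m} k R → length R ≡ suc m → length (proj₂ (pickBit k R)) ≡ m
pickBit-length k (b ∷ R) eq = ℕ.suc-injective (trans (↭-length (pick-↭ k b R)) eq)

permute-pickBit : ∀ {m b S} k ks R → length R ≡ suc m → pickBit k R ≡ (b , S) →
                  permute (k ∷ ks) R ≡ b ∷ permute ks S
permute-pickBit k ks (c ∷ R) _ eq = cong (λ r → proj₁ r ∷ permute ks (proj₂ r)) eq

pickBit-zero : ∀ {m b S} R → length R ≡ suc m → pickBit 0 R ≡ (b , S) → R ≡ b ∷ S
pickBit-zero (c ∷ R) _ refl = refl

eqLength-∈ : ∀ {R} t u → T (eqLength t u) → R ∈ t → ∃[ S ] S ∈ u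
eqLength-∈ (_ ∷ t) (S ∷ u) _ _ = S , here refl

eqLength-sym : ∀ t u → T (eqLength t u) → T (eqLength u t)
eqLength-sym [] [] _ = _
eqLength-sym (_ ∷ t) (_ ∷ u) = eqLength-sym t u

inhabited⁺ : ∀ {R t u} → R ∈ t → T (inhabited (t , u))
inhabited⁺ (here _) = _
inhabited⁺ (there _) = _

HasWidth : ℕ → Group → Set
HasWidth m (t , u) = ∀ {R} → R ∈ t ⊎ R ∈ u → length R ≡ m

Matches : List ℕ → Group → Set
Matches ks (t , u) = (∀ {R} → R ∈ t → permute ks R ∈ u) × (∀ {S} → S ∈ u → ∃[ R ] R ∈ t × S ≡ permute ks R)

length-zero : ∀ {R : Row} → length R ≡ 0 → R ≡ []
length-zero {[]} _ = refl

split-width : ∀ {m k b t u} → HasWidth (suc m) (t , u) → HasWidth m (selectBit b k t , selectBit b 0 u)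
split-width {k = k} {b} {t} w (inj₁ R∈) with ∈-selectBit⁻ {b} {k} t R∈
... | S , S∈ , eq = trans (cong (length ∘ proj₂) (sym eq)) (pickBit-length k S (w (inj₁ S∈)))
split-width {b = b} {u = u} w (inj₂ R∈) with ∈-selectBit⁻ {b} {0} u R∈
... | S , S∈ , eq = trans (cong (length ∘ proj₂) (sym eq)) (pickBit-length 0 S (w (inj₂ S∈)))

∈-splitBy : ∀ {k t u} b → (selectBit b k t , selectBit b 0 u) ∈ splitBy k (t , u)
∈-splitBy true = here refl
∈-splitBy false = there (here refl)

refine-sound : ∀ m gs → (∀ {g} → g ∈ gs → HasWidth m g × T (balanced g)) → T (refine m gs) →
               ∃[ ks ] (∀ {g} → g ∈ gs → Matches ks g)
check-sound : ∀ m gs → (∀ {g} → g ∈ gs → HasWidth m g) → T (check m gs) →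
              ∃[ ks ] (∀ {g} → g ∈ gs → Matches ks g)

-- All rows have become empty, so a row on one side matches any row on the other, and balance
-- provides one.
refine-sound zero gs inv _ = [] , λ { {t , u} g∈ → let w , bal = inv g∈ in
    (λ R∈ → let S , S∈ = eqLength-∈ t u bal R∈
            in subst (_∈ u) (trans (length-zero (w (inj₂ S∈))) (sym (length-zero (w (inj₁ R∈))))) S∈)
  , (λ S∈ → let R , R∈ = eqLength-∈ u t (eqLength-sym t u bal) S∈
            in R , R∈ , trans (length-zero (w (inj₂ S∈))) (sym (length-zero (w (inj₁ R∈))))) }
refine-sound (suc m) gs inv e with any⁻ (λ k → check m (concatMap (splitBy k) gs)) (upTo (suc m)) e
... | k , _ , ch with check-sound m (concatMap (splitBy k) gs) widths ch
  where
  widths : ∀ {g} → g ∈ concatMap (splitBy k) gs → HasWidth m g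
  widths g∈ with find (∈-concatMap⁻ (splitBy k) {xs = gs} g∈)
  ... | g′ , g′∈ , here refl = split-width {k = k} {true} {proj₁ g′} (proj₁ (inv g′∈))
  ... | g′ , g′∈ , there (here refl) = split-width {k = k} {false} {proj₁ g′} (proj₁ (inv g′∈))
... | ks , match = k ∷ ks , λ { {t , u} g∈ → fwd g∈ , bwd g∈ }
  where
  parts : ∀ {t u} b → (t , u) ∈ gs → Matches ks (selectBit b k t , selectBit b 0 u)
  parts {t} {u} b g∈ = match (∈-concatMap⁺ (splitBy k) (Any.map (λ { refl → ∈-splitBy {k} {t} {u} b }) g∈))
  fwd : ∀ {t u R} → (t , u) ∈ gs → R ∈ t → permute (k ∷ ks) R ∈ u
  fwd {t} {u} {R} g∈ R∈
    with ∈-selectBit⁻ {proj₁ (pickBit k R)} {0} u (proj₁ (parts (proj₁ (pickBit k R)) g∈) (∈-selectBit⁺ {k} R∈))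
  ... | S , S∈ , eq = subst (_∈ u) (trans (pickBit-zero S (proj₁ (inv g∈) (inj₂ S∈)) eq)
                                          (sym (permute-pickBit k ks R (proj₁ (inv g∈) (inj₁ R∈)) refl))) S∈
  bwd : ∀ {t u S} → (t , u) ∈ gs → S ∈ u → ∃[ R ] R ∈ t × S ≡ permute (k ∷ ks) R
  bwd {t} {u} {S} g∈ S∈ with proj₂ (parts (proj₁ (pickBit 0 S)) g∈) (∈-selectBit⁺ {0} S∈)
  ... | R′ , R′∈ , eq′ with ∈-selectBit⁻ {proj₁ (pickBit 0 S)} {k} t R′∈
  ...   | R , R∈ , eq = R , R∈ , trans (pickBit-zero S (proj₁ (inv g∈) (inj₂ S∈)) (cong (proj₁ (pickBit 0 S) ,_) eq′))
                                       (sym (permute-pickBit k ks R (proj₁ (inv g∈) (inj₁ R∈)) eq))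

check-sound m gs widths e with T-∧⁻ {all balanced gs} e
... | bal , ref with refine-sound m (filterᵇ inhabited gs) inv ref
  where
  inv : ∀ {g} → g ∈ filterᵇ inhabited gs → HasWidth m g × T (balanced g)
  inv g∈ = let g∈′ , _ = ∈-filterᵇ⁻ inhabited gs g∈ in widths g∈′ , all⁻ balanced bal g∈′
-- A group that was filtered out is empty on the left, hence on the right by balance, so it matches
-- vacuously.
... | ks , match = ks , λ { {t , u} g∈ →
    (λ R∈ → proj₁ (match (∈-filterᵇ⁺ inhabited g∈ (inhabited⁺ {u = u} R∈))) R∈)
  , (λ S∈ → let R , R∈ = eqLength-∈ u t (eqLength-sym t u (all⁻ balanced bal g∈)) S∈
            in proj₂ (match (∈-filterᵇ⁺ inhabited g∈ (inhabited⁺ {u = u} R∈))) S∈) }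

group-cases : ∀ (p : Row → Bool) {R} t → R ∈ t → R ∈ filterᵇ p t ⊎ R ∈ filterᵇ (not ∘ p) t
group-cases p {R} t R∈ with T? (p R)
... | yes pR = inj₁ (∈-filterᵇ⁺ p R∈ pR)
... | no ¬pR = inj₂ (∈-filterᵇ⁺ (not ∘ p) R∈ (¬T⇒T-not ¬pR))

groupBySize-⊆ : ∀ sizes t u {g} → g ∈ groupBySize sizes t u →
                (∀ {R} → R ∈ proj₁ g → R ∈ t) × (∀ {R} → R ∈ proj₂ g → R ∈ u)
groupBySize-⊆ [] t u (here refl) = id , id
groupBySize-⊆ (k ∷ ks) t u (here refl) =
  (proj₁ ∘ ∈-filterᵇ⁻ (λ R → size R ≡ᵇ k) t) , (proj₁ ∘ ∈-filterᵇ⁻ (λ R → size R ≡ᵇ k) u)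
groupBySize-⊆ (k ∷ ks) t u (there g∈) =
  let p , q = groupBySize-⊆ ks _ _ g∈
  in (proj₁ ∘ ∈-filterᵇ⁻ (λ R → not (size R ≡ᵇ k)) t ∘ p) , (proj₁ ∘ ∈-filterᵇ⁻ (λ R → not (size R ≡ᵇ k)) u ∘ q)

groupBySize-matches : ∀ ks sizes t u → (∀ {g} → g ∈ groupBySize sizes t u → Matches ks g) → Matches ks (t , u)
groupBySize-matches ks [] t u match = match (here refl)
groupBySize-matches ks (k ∷ sizes) t u match = fwd , bwd
  where
  p : Row → Bool
  p R = size R ≡ᵇ k
  rest : Matches ks (filterᵇ (not ∘ p) t , filterᵇ (not ∘ p) u)
  rest = groupBySize-matches ks sizes _ _ (match ∘ there)
  fwd : ∀ {R} → R ∈ t → permute ks R ∈ u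
  fwd R∈ with group-cases p t R∈
  ... | inj₁ R∈′ = proj₁ (∈-filterᵇ⁻ p u (proj₁ (match (here refl)) R∈′))
  ... | inj₂ R∈′ = proj₁ (∈-filterᵇ⁻ (not ∘ p) u (proj₁ rest R∈′))
  bwd : ∀ {S} → S ∈ u → ∃[ R ] R ∈ t × S ≡ permute ks R
  bwd S∈ with group-cases p u S∈
  ... | inj₁ S∈′ = let R , R∈ , eq = proj₂ (match (here refl)) S∈′ in R , proj₁ (∈-filterᵇ⁻ p t R∈) , eq
  ... | inj₂ S∈′ = let R , R∈ , eq = proj₂ rest S∈′ in R , proj₁ (∈-filterᵇ⁻ (not ∘ p) t R∈) , eq

isomorphic-sound : ∀ {r t s u} → T (isomorphic (r , t) (s , u)) →
                   ∃[ ks ] permute ks r ≡ s × Matches ks (t , u)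
isomorphic-sound {r} {t} {s} {u} e
  with len , e₁ ← T-∧⁻ {length r ≡ᵇ length s} e
  with _ , e₂ ← T-∧⁻ {size r ≡ᵇ size s} e₁
  with _ , e₃ ← T-∧⁻ {eqLength t u} e₂
  with ch , wid ← T-∧⁻ {check (length r) ((r ∷ [] , s ∷ []) ∷ groupBySize (2 ∷ 3 ∷ 4 ∷ []) t u)} e₃
  with check-sound _ _ widths ch
  where
  width : ∀ {R} → R ∈ t ++ u → length R ≡ length r
  width R∈ = ℕ.≡ᵇ⇒≡ _ _ (all⁻ (λ R → length R ≡ᵇ length r) wid R∈)
  widths : ∀ {g} → g ∈ (r ∷ [] , s ∷ []) ∷ groupBySize (2 ∷ 3 ∷ 4 ∷ []) t u → HasWidth (length r) g
  widths (here refl) (inj₁ (here refl)) = refl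
  widths (here refl) (inj₂ (here refl)) = sym (ℕ.≡ᵇ⇒≡ (length r) (length s) len)
  widths (there g∈) (inj₁ R∈) = width (∈-++⁺ˡ (proj₁ (groupBySize-⊆ (2 ∷ 3 ∷ 4 ∷ []) t u g∈) R∈))
  widths (there g∈) (inj₂ R∈) = width (∈-++⁺ʳ t (proj₂ (groupBySize-⊆ (2 ∷ 3 ∷ 4 ∷ []) t u g∈) R∈))
... | ks , match with proj₁ (match (here refl)) (here refl)
...   | here eq = ks , eq , groupBySize-matches ks (2 ∷ 3 ∷ 4 ∷ []) t u (match ∘ there)

-- A table is discarded only after a positive test against a kept one, and the permutation found
-- fixes `r` because both are tested with the same colour row.
dedupe-complete : ∀ r {t} ts → t ∈ ts → ∃[ u ] u ∈ dedupe r ts × (t ≡ u ⊎ ∃[ ks ] permute ks r ≡ r × Matches ks (t , u))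
dedupe-complete r (t ∷ ts) t∈ with any (λ u → isomorphic (r , t) (r , u)) (dedupe r ts) in eq
dedupe-complete r (t ∷ ts) (here refl) | true =
  let u , u∈ , iso = any⁻ (λ u → isomorphic (r , t) (r , u)) (dedupe r ts) (subst T (sym eq) _) 
      ks , fixed , match = isomorphic-sound {r} {t} {r} {u} iso
  in u , u∈ , inj₂ (ks , fixed , match)
dedupe-complete r (t ∷ ts) (here refl) | false = t , here refl , inj₁ refl
dedupe-complete r (t ∷ ts) (there t∈) | true = dedupe-complete r ts t∈
dedupe-complete r (t ∷ ts) (there t∈) | false =
  let u , u∈ , same = dedupe-complete r ts t∈ in u , there u∈ , same

-- Linear spaces induced on a set of points

module _ (G : Geom) (fls : IsFLS G) where
  open Traces G fls

  -- Permuting the placed points permutes the columns of every trace alike. Thus a representative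
  -- table presents the same geometry `G` along a reordered list of points.
  permute-presents : ∀ {ks ps t u} → Matches ks (t , u) → Presents ps t → Presents (permute ks ps) u
  permute-presents {ks} {ps} {t} {u} (fwd , bwd) (presents sound complete) = presents snd cmp
    where
    into : ∀ {x} → x ∈ ps → x ∈ permute ks ps
    into = ∈-resp-↭ (↭-sym (permute-↭ ks ps))
    out : ∀ {x} → x ∈ permute ks ps → x ∈ ps
    out = ∈-resp-↭ (permute-↭ ks ps)
    snd : ∀ {S} → S ∈ u → ∃[ l ] Secant (permute ks ps) l × S ≡ trace l (permute ks ps)
    snd S∈ with bwd S∈
    ... | R , R∈ , refl with sound R∈
    ...   | l , secant x≢y x∈ y∈ lx ly , refl =
      l , secant x≢y (into x∈) (into y∈) lx ly , permute-map (incident G l) ks ps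
    cmp : ∀ {l} → Secant (permute ks ps) l → trace l (permute ks ps) ∈ u
    cmp {l} (secant x≢y x∈ y∈ lx ly) =
      subst (_∈ u) (permute-map (incident G l) ks ps) (fwd (complete (secant x≢y (out x∈) (out y∈) lx ly)))

  -- The points are placed one by one, and replacing a table by its representative may reorder them;
  -- hence `ps` is only a permutation of `qs`.
  linearSpaces-complete : ∀ {qs} → Unique qs →
    ∃[ ps ] ∃[ t ] t ∈ linearSpaces (length qs) × ps ↭ qs × Presents ps t
  linearSpaces-complete {[]} [] = [] , [] , here refl , ↭-refl , presents (λ ()) λ { (secant _ () _ _ _) }
  linearSpaces-complete {q ∷ qs} (q# ∷ u) with linearSpaces-complete u
  ... | ps , t , t∈ , ps↭ , pres = conclude (dedupe-complete (replicate (suc n) false) children child∈)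
    where
    n = length qs
    q∉ : q ∉ ps
    q∉ q∈ = All.lookup q# (∈-resp-↭ ps↭ q∈) refl
    ps-unique : Unique ps
    ps-unique = Unique-resp-↭ (setoid _) (↭⇒↭ₛ (↭-sym ps↭)) u
    followed : ∃[ f ] f ∈ finish [] t [] × Follows ps t q ⟨ proj₁ f , [] , proj₂ f ⟩
    followed = finish-follows q∉ pres (nothing-decided q∉ pres)
    f = proj₁ followed
    extensions : Table → List Table
    extensions t = map (child (replicate n false)) (finish [] t [])
    children : List Table
    children = concatMap extensions (linearSpaces n)
    child∈ : child (replicate n false) f ∈ children
    child∈ = ∈-concatMap⁺ extensions (Any.map (λ { refl → ∈-map⁺ (child _) (proj₁ (proj₂ followed)) }) t∈)
    blank : ∀ (xs : List (Fin (pts G))) → map (λ _ → false) xs ≡ replicate (length xs) false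
    blank [] = refl
    blank (_ ∷ xs) = cong (false ∷_) (blank xs)
    child-pres : Presents (q ∷ ps) (child (replicate n false) f)
    child-pres = subst (λ ∅ → Presents (q ∷ ps) (child ∅ f))
                       (trans (blank ps) (cong (λ k → replicate k false) (↭-length ps↭)))
                       (child-presents q∉ pres ps-unique (proj₂ (proj₂ followed)))
    blank₁ : Row
    blank₁ = replicate (suc n) false
    conclude : ∃[ v ] v ∈ linearSpaces (suc n) ×
                 (child (replicate n false) f ≡ v ⊎
                  ∃[ ks ] permute ks blank₁ ≡ blank₁ × Matches ks (child (replicate n false) f , v)) →
               ∃[ ps′ ] ∃[ v ] v ∈ linearSpaces (suc n) × ps′ ↭ q ∷ qs × Presents ps′ v
    conclude (v , v∈ , inj₁ refl) = q ∷ ps , v , v∈ , prep q ps↭ , child-pres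
    conclude (v , v∈ , inj₂ (ks , _ , match)) =
      permute ks (q ∷ ps) , v , v∈ , ↭-trans (permute-↭ ks (q ∷ ps)) (prep q ps↭)
         , permute-presents {ks} match child-pres

-- The search for the red points

isRed : Colour → Bool
isRed red   = true
isRed green = false

-- The choice of the line to branch on is a heuristic: only better-choice matters.
less : Row → Row → Bool
less (false ∷ R) (true ∷ S) = true
less (true ∷ R) (false ∷ S) = false
less (_ ∷ R) (_ ∷ S) = less R S
less _ _ = false

better : Row → Row → Row
better R S =
  if size R <ᵇ size S then S else
  if size S <ᵇ size R then R else
  if less R S then R else S

distinct : List Row → Bool
distinct [] = true
distinct (R ∷ Rs) = not (any (same R) Rs) ∧ distinct Rs

-- Rows may repeat, and copies of one line can share a new point, so the bound applies only when the
-- rows are pairwise distinct.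
overfull : ℕ → List Row → Bool
overfull room Rs = (room <ᵇ length Rs) ∧ distinct Rs

addRow : Row → List ℕ → List ℕ
addRow (true ∷ R) (k ∷ ks) = suc k ∷ addRow R ks
addRow (false ∷ R) (k ∷ ks) = k ∷ addRow R ks
addRow _ _ = []

-- The column sums only serve to skip the costly exact test when it must fail.
crowded : ℕ → Row → Table → Bool
crowded room reds mono =
  any (room <ᵇ_) (foldr addRow (map (λ _ → 0) reds) mono) ∧
  any (λ e → overfull room (filterᵇ (meets e) mono)) (singletons∉ reds)

monochromatic : Row → Table → Table
monochromatic reds t = filterᵇ (λ R → not (meets reds R)) t

-- The singletons formed here are the placed red points. Their lines to the new point contain placed
-- green points, so they are existing rows and have to be chosen; lines to green points may be new
-- and are left to `finish` and `child`.
children : Row → Choice → List Table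
children reds c =
  concatMap (λ d → map (child (map (λ _ → false) reds)) (finish (Choice.on d) (Choice.undecided d) (Choice.off d)))
            (expands (singletons∉ (map not reds)) (c ∷ []))

promising : ℕ → Row → List Table → List Table
promising room reds ts = dedupe reds (filterᵇ (λ t → not (crowded room reds (monochromatic reds t))) ts)

module _ (ok : Row → Table → Bool) where

  -- Adds up to room red points; the last argument of visit lists the
  -- monochromatic lines, one of which the next point must lie on.
  explore : ℕ → Row → Table → Bool
  visit   : ℕ → Row → Table → Table → Bool
  extend  : ℕ → Row → Choice → Bool

  explore room reds t = visit room reds t (monochromatic reds t)

  -- All points may be placed already, so the node has to be accepted; if not, any further red point
  -- may follow, with no line prescribed.
  visit room reds t [] = ok reds t ∧ extend room reds ⟨ [] , t , [] ⟩
  visit room reds t (R ∷ mono) = extend room reds (choose (foldr better R mono) ⟨ [] , t , [] ⟩)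

  -- Without room a further point cannot exist, so nothing remains to be checked.
  extend zero reds c = true
  extend (suc room) reds c = all (explore room (true ∷ reds)) (promising room (true ∷ reds) (children reds c))

better-choice : ∀ R S → better R S ≡ R ⊎ better R S ≡ S
better-choice R S with size R <ᵇ size S
... | true = inj₂ refl
... | false with size S <ᵇ size R
...   | true = inj₁ refl
...   | false with less R S
...     | true = inj₁ refl
...     | false = inj₂ refl

foldr-better-∈ : ∀ R mono → foldr better R mono ∈ R ∷ mono
foldr-better-∈ R [] = here refl
foldr-better-∈ R (S ∷ mono) with better-choice S (foldr better R mono)
... | inj₁ eq = there (here eq)
... | inj₂ eq with foldr-better-∈ R mono
...   | here eq′ = here (trans eq eq′)
...   | there ∈mono = there (there (subst (_∈ mono) (sym eq) ∈mono))

distinct⇒Unique : ∀ Rs → T (distinct Rs) → Unique Rs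
distinct⇒Unique [] _ = []
distinct⇒Unique (R ∷ Rs) t =
  let new , rest = T-∧⁻ {not (any (same R) Rs)} t
  in All.tabulate (λ { S∈ refl → T-not⇒¬T new (any⁺ (same R) S∈ (same-refl R)) }) ∷ distinct⇒Unique Rs rest

module Search (G : Geom) (mr : IsMR G) (n : ℕ) (v≤n : pts G ≤ n)
              (ok : Row → Table → Bool) (Goal : Set) where
  open Traces G (IsMR.fls mr)
  private
    Point = Fin (pts G)
    inc   = incident G

  isRedPoint : Point → Bool
  isRedPoint x = isRed (colour G x)

  red-on : ∀ l → ∃[ x ] T (inc l x) × T (isRedPoint x)
  red-on l = let x , x∈ , eq = IsMR.hasRed mr l in x , ∈⇒inc x∈ , subst (T ∘ isRed) (sym eq) _

  green-on : ∀ l → ∃[ x ] T (inc l x) × ¬ T (isRedPoint x)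
  green-on l = let x , x∈ , eq = IsMR.hasGreen mr l in x , ∈⇒inc x∈ , λ t → subst (T ∘ isRed) eq t

  module _ (ok-sound : ∀ {ps t} → Unique ps → (∀ x → x ∈ ps) → Presents ps t →
                       T (ok (map isRedPoint ps) t) → Goal) where

    -- `room` is counted up to the bound `n` rather than to `pts G`, so one search serves geometries
    -- of every size up to `n`.
    record State (room : ℕ) (ps : List Point) (t : Table) : Set where
      field
        uniq   : Unique ps
        greens : ∀ x → ¬ T (isRedPoint x) → x ∈ ps
        count  : length ps + room ≡ n
        table  : Presents ps t
    open State

    private
      reds : List Point → Row
      reds = map isRedPoint

    full? : ∀ (ps : List Point) → (∀ x → x ∈ ps) ⊎ ∃[ x ] x ∉ ps
    full? ps with Fin.all? (λ x → x ∈? ps)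
      where open DecMembership _≟F_ using (_∈?_)
    ... | yes all∈ = inj₁ all∈
    ... | no ¬all∈ = inj₂ (Fin.¬∀⟶∃¬ _ _ (λ x → x ∈? ps) ¬all∈)
      where open DecMembership _≟F_ using (_∈?_)

    -- The line has a red point by the axioms; as no placed point of it is red, this one is still to
    -- be placed.
    mono-row : ∀ {room ps t R} → State room ps t → R ∈ t → ¬ T (meets (reds ps) R) →
               ∃[ x ] x ∉ ps × T (isRedPoint x) × Through ps x R
    mono-row {ps = ps} st R∈ ¬red with Presents.sound (table st) R∈
    ... | l , _ , refl with red-on l
    ...   | x , lx , rx = x , (λ x∈ → ¬red (meets⁺ isRedPoint (inc l) x∈ rx lx)) , rx , l , lx , refl

    -- Distinct monochromatic lines through z need distinct new points.
    hitting-points : ∀ {ps} z Rs → Unique Rs →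
                     (∀ {R} → R ∈ Rs → T (meets (map (point _≟F_ z) ps) R) × ∃[ x ] x ∉ ps × Through ps x R) →
                     ∃[ xs ] length xs ≡ length Rs × Unique xs ×
                             (∀ {x} → x ∈ xs → x ∉ ps × ∃[ R ] R ∈ Rs × Through ps x R)
    hitting-points z [] _ _ = [] , refl , [] , λ ()
    hitting-points {ps} z (R ∷ Rs) (R# ∷ u) hit with hit (here refl) | hitting-points z Rs u (hit ∘ there)
    ... | zR , x , x∉ , thr | xs , len , uxs , props =
      x ∷ xs , cong suc len , All.tabulate x-new ∷ uxs , λ
        { (here refl) → x∉ , R , here refl , thr
        ; (there y∈) → let y∉ , S , S∈ , thr′ = props y∈ in y∉ , S , there S∈ , thr′ }
      where
      x-new : ∀ {y} → y ∈ xs → x ≢ y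
      x-new y∈ refl with props y∈
      ... | _ , S , S∈ , thr′ = All.lookup R# S∈ (through-unique {q = z} x∉ thr thr′ zR (proj₁ (hit (there S∈))))

    -- More than `room` distinct monochromatic rows through a point `z` would need as many new
    -- points, giving more than `n` points together with `ps`.
    not-crowded : ∀ {room ps t mono} → State room ps t → (∀ {R} → R ∈ mono → R ∈ t × ¬ T (meets (reds ps) R)) →
                  ¬ T (crowded room (reds ps) mono)
    not-crowded {room} {ps} {t} {mono} st monoR cr
      with any⁻ _ (singletons∉ (reds ps))
             (proj₂ (T-∧⁻ {any (room <ᵇ_) (foldr addRow (map (λ _ → 0) (reds ps)) mono)} cr))
    ... | e , e∈ , over with singletons∉⁻ _≟F_ isRedPoint (uniq st) e∈
    ...   | z , _ , _ , refl
      with T-∧⁻ {room <ᵇ length (filterᵇ (meets (map (point _≟F_ z) ps)) mono)} over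
    ...   | big , dis
      with hitting-points z (filterᵇ (meets (map (point _≟F_ z) ps)) mono) (distinct⇒Unique _ dis) hit
      where
      hit : ∀ {R} → R ∈ filterᵇ (meets (map (point _≟F_ z) ps)) mono →
            T (meets (map (point _≟F_ z) ps) R) × ∃[ x ] x ∉ ps × Through ps x R
      hit R∈ with ∈-filterᵇ⁻ _ mono R∈
      ... | R∈mono , zR = let R∈t , ¬r = monoR R∈mono ; x , x∉ , _ , thr = mono-row st R∈t ¬r in zR , x , x∉ , thr
    ... | xs , len , uxs , props = ℕ.<⇒≱ too-many (ℕ.≤-trans (unique-length (++⁺ uxs (uniq st) disjoint)) v≤n)
      where
      disjoint : ∀ {x} → ¬ (x ∈ xs × x ∈ ps)
      disjoint (x∈ , x∈ps) = proj₁ (props x∈) x∈ps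
      too-many : n < length (xs ++ ps)
      too-many = ℕ.≤-trans (ℕ.≤-reflexive (cong suc (trans (sym (count st)) (ℕ.+-comm (length ps) room))))
                 (ℕ.≤-trans (ℕ.+-monoˡ-≤ (length ps) (ℕ.≤-trans (ℕ.<ᵇ⇒< _ _ big) (ℕ.≤-reflexive (sym len))))
                          (ℕ.≤-reflexive (sym (length-++ xs))))

    private
      not-reds : ∀ ps → map not (reds ps) ≡ map (not ∘ isRedPoint) ps
      not-reds ps = sym (map-∘ ps)

    private
      mono⁻ : ∀ {ps t R} → R ∈ monochromatic (reds ps) t → R ∈ t × ¬ T (meets (reds ps) R)
      mono⁻ {ps} {t} R∈ =
        let R∈t , ¬r = ∈-filterᵇ⁻ (λ R → not (meets (reds ps) R)) t R∈ in R∈t , T-not⇒¬T ¬r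

      permute-state : ∀ {room ps t u ks} → Matches ks (t , u) → State room ps t → State room (permute ks ps) u
      permute-state {ps = ps} {ks = ks} match st = record
        { uniq = Unique-resp-↭ (setoid _) (↭⇒↭ₛ (↭-sym (permute-↭ ks ps))) (uniq st)
        ; greens = λ x ¬r → ∈-resp-↭ (↭-sym (permute-↭ ks ps)) (greens st x ¬r)
        ; count = trans (cong (_+ _) (↭-length (permute-↭ ks ps))) (count st)
        ; table = permute-presents G (IsMR.fls mr) {ks} match (table st) }

    -- The geometry itself selects the branch: its next red point decides which rows pass through
    -- it. Following this one branch leads to `Goal` because the search has checked all of them.
    explore-sound : ∀ {room ps t} → State room ps t → T (explore ok room (reds ps) t) → Goal
    visit-sound : ∀ {room ps t} mono → State room ps t → (∀ {R} → R ∈ mono → R ∈ t × ¬ T (meets (reds ps) R)) →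
                  T (visit ok room (reds ps) t mono) → Goal
    extend-sound : ∀ {room ps t p c} → State room ps t → p ∉ ps → T (isRedPoint p) → Follows ps t p c →
                   T (extend ok room (reds ps) c) → Goal

    explore-sound {ps = ps} {t} st = visit-sound (monochromatic (reds ps) t) st (mono⁻ {ps} {t})

    visit-sound {room} {ps} {t} [] st _ e with T-∧⁻ {ok (reds ps) t} e | full? ps
    ... | okt , _ | inj₁ all∈ = ok-sound (uniq st) all∈ (table st) okt
    ... | _ , ext | inj₂ (p , p∉) with T? (isRedPoint p)
    ...   | yes rp = extend-sound st p∉ rp (nothing-decided p∉ (table st)) ext
    ...   | no ¬rp = contradiction (greens st p ¬rp) p∉
    visit-sound {room} {ps} {t} (R ∷ mono) st monoR e =
      let R∈t , ¬r = monoR (foldr-better-∈ R mono)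
          p , p∉ , rp , thr = mono-row st R∈t ¬r
      in extend-sound st p∉ rp (choose-follows p∉ (table st) (nothing-decided p∉ (table st)) R∈t thr) e

    extend-sound {zero} {ps} st p∉ _ _ _ =
      contradiction (ℕ.≤-trans (unique-length (All.tabulate (λ { x∈ refl → p∉ x∈ }) ∷ uniq st)) v≤n)
                    (ℕ.<⇒≱ (ℕ.≤-reflexive (cong suc (trans (sym (count st)) (ℕ.+-comm (length ps) 0)))))
    extend-sound {suc room} {ps} {t} {p} {c} st p∉ rp fol e
      with expands-follows p∉ (table st) {singletons∉ (map not (reds ps))} (here refl) fol joined
      where
      joined : ∀ {e} → e ∈ singletons∉ (map not (reds ps)) → ∃[ R ] R ∈ t × Through ps p R × T (meets e R)
      joined e∈ rewrite not-reds ps with singletons∉⁻ _≟F_ (not ∘ isRedPoint) (uniq st) e∈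
      ... | q , q∈ , ¬¬rq , refl with join {p} {q} (λ { refl → p∉ q∈ })
      ...   | l , lp , lq with green-on l
      -- The green point `z` is placed and differs from the red `q`, so the line through `p` and `q`
      -- is already a secant of `ps`.
      ...     | z , lz , ¬rz =
        trace l ps
        , Presents.complete (table st) (secant (λ { refl → ¬rz (red-q) }) q∈ (greens st z ¬rz) lq lz)
        , (l , lp , refl)
        , meets⁺ (point _≟F_ q) (inc l) q∈ (point-refl _≟F_ q) lq
        where
        red-q : T (isRedPoint q)
        red-q with T? (isRedPoint q)
        ... | yes rq = rq
        ... | no ¬rq = contradiction (¬T⇒T-not ¬rq) ¬¬rq
    ... | c′ , c′∈ , fol′ with finish-follows p∉ (table st) fol′
    ...   | f , f∈ , fol″ = conclude (dedupe-complete reds⁺ _ promising∈)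
      where
      t′ : Table
      t′ = child (map (λ _ → false) ps) f
      reds⁺ : Row
      reds⁺ = true ∷ reds ps
      reds⁺≡ : reds (p ∷ ps) ≡ reds⁺
      reds⁺≡ = cong (_∷ reds ps) (T⇒≡true rp)
      st′ : State room (p ∷ ps) t′
      st′ = record
        { uniq = All.tabulate (λ { x∈ refl → p∉ x∈ }) ∷ uniq st
        ; greens = λ x ¬rx → there (greens st x ¬rx)
        ; count = trans (sym (ℕ.+-suc (length ps) room)) (count st)
        ; table = child-presents p∉ (table st) (uniq st) fol″ }
      complete : Choice → List Table
      complete d = map (child (map (λ _ → false) (reds ps))) (finish (Choice.on d) (Choice.undecided d) (Choice.off d))
      t′∈ : t′ ∈ children (reds ps) c
      t′∈ = subst (λ ∅ → child ∅ f ∈ children (reds ps) c) (sym (map-∘ ps))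
              (∈-concatMap⁺ complete (Any.map (λ { refl → ∈-map⁺ (child (map (λ _ → false) (reds ps))) f∈ }) c′∈))
      sparse : Table → Bool
      sparse t = not (crowded room reds⁺ (monochromatic reds⁺ t))
      promising∈ : t′ ∈ filterᵇ sparse (children (reds ps) c)
      promising∈ = ∈-filterᵇ⁺ sparse t′∈
        (subst (λ r → T (not (crowded room r (monochromatic r t′)))) reds⁺≡
          (¬T⇒T-not (not-crowded st′ (mono⁻ {p ∷ ps} {t′}))))
      explored : ∀ {ps′ u} → State room ps′ u → reds ps′ ≡ reds⁺ →
                 u ∈ promising room reds⁺ (children (reds ps) c) → Goal
      explored {u = u} st″ eq u∈ =
        explore-sound st″ (subst (λ r → T (explore ok room r u)) (sym eq) (all⁻ (explore ok room reds⁺) e u∈))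
      conclude : (∃[ u ] u ∈ promising room reds⁺ (children (reds ps) c) ×
                   (t′ ≡ u ⊎ ∃[ ks ] permute ks reds⁺ ≡ reds⁺ × Matches ks (t′ , u))) → Goal
      conclude (u , u∈ , inj₁ refl) = explored st′ reds⁺≡ u∈
      conclude (u , u∈ , inj₂ (ks , fixed , match)) = explored (permute-state {ks = ks} match st′)
        (trans (sym (permute-map isRedPoint ks (p ∷ ps))) (trans (cong (permute ks) reds⁺≡) fixed)) u∈

-- Tables of whole geometries

redRow : Geom → Row
redRow G = map (isRed ∘ colour G) (allFin (pts G))

tableOf : Geom → Row × Table
tableOf G = redRow G , map (λ l → map (incident G l) (allFin (pts G))) (allFin (nlines G))

isRed-injective : ∀ {c d} → isRed c ≡ isRed d → c ≡ d
isRed-injective {red} {red} _ = refl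
isRed-injective {green} {green} _ = refl

isRed-swap : ∀ c → isRed (swapColour c) ≡ not (isRed c)
isRed-swap red = refl
isRed-swap green = refl

swapColour-involutive : ∀ c → swapColour (swapColour c) ≡ c
swapColour-involutive red = refl
swapColour-involutive green = refl

-- Isomorphisms from a common table

lookup-map≡ : ∀ {f : A → C} {g : B → C} {xs ys} → map f xs ≡ map g ys → (len : length xs ≡ length ys) →
              ∀ i → f (lookup xs i) ≡ g (lookup ys (cast len i))
lookup-map≡ {xs = _ ∷ _} {_ ∷ _} eq len zero = ∷-injectiveˡ eq
lookup-map≡ {xs = _ ∷ _} {_ ∷ _} eq len (suc i) = lookup-map≡ (∷-injectiveʳ eq) (ℕ.suc-injective len) i

map≡⇒length≡ : ∀ {f : A → C} {g : B → C} xs ys → map f xs ≡ map g ys → length xs ≡ length ys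
map≡⇒length≡ {f = f} {g} xs ys eq = trans (sym (length-map f xs)) (trans (cong length eq) (length-map g ys))

size-toList : ∀ {n} (S : Subset.Subset n) → size (Vec.toList S) ≡ Subset.∣ S ∣
size-toList Vec.[] = refl
size-toList (true Vec.∷ S) = cong suc (size-toList S)
size-toList (false Vec.∷ S) = size-toList S

some-member : ∀ {n} (S : Subset.Subset n) → 1 ≤ Subset.∣ S ∣ → ∃[ x ] T (Vec.lookup S x)
some-member (true Vec.∷ S) _ = zero , _
some-member (false Vec.∷ S) le = let x , x∈ = some-member S le in suc x , x∈

two-members : ∀ {n} (S : Subset.Subset n) → 2 ≤ Subset.∣ S ∣ →
              ∃[ x ] ∃[ y ] x ≢ y × T (Vec.lookup S x) × T (Vec.lookup S y)
two-members (true Vec.∷ S) (s≤s le) = let y , y∈ = some-member S le in zero , suc y , (λ ()) , _ , y∈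
two-members (false Vec.∷ S) le =
  let x , y , x≢y , x∈ , y∈ = two-members S le in suc x , suc y , x≢y ∘ Fin.suc-injective , x∈ , y∈

line-secant : ∀ G (fls : IsFLS G) {ps} → (∀ x → x ∈ ps) → ∀ l → Traces.Secant G fls ps l
line-secant G fls full l =
  let x , y , x≢y , lx , ly = two-members (line G l) (IsFLS.lineSize fls l)
  in Traces.secant x≢y (full x) (full y) lx ly

tableOf-presents : ∀ G (fls : IsFLS G) → Traces.Presents G fls (allFin (pts G)) (proj₂ (tableOf G))
tableOf-presents G fls = Traces.presents
  (λ R∈ → let l , _ , eq = ∈-map⁻ (λ l → Traces.trace G fls l (allFin (pts G))) R∈
          in l , line-secant G fls ∈-allFin l , eq)
  (λ {l} _ → ∈-map⁺ (λ l → Traces.trace G fls l (allFin (pts G))) (∈-allFin l))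

module SameTable (G H : Geom) (flsG : IsFLS G) (flsH : IsFLS H)
  {ps : List (Fin (pts G))} {qs : List (Fin (pts H))} {t : Table}
  (ps! : Unique ps) (qs! : Unique qs) (ps-full : ∀ x → x ∈ ps) (qs-full : ∀ y → y ∈ qs)
  (presG : Traces.Presents G flsG ps t) (presH : Traces.Presents H flsH qs t)
  (reds≡ : map (isRed ∘ colour G) ps ≡ map (isRed ∘ colour H) qs) where
  private
    module TG = Traces G flsG
    module TH = Traces H flsH

    len : length ps ≡ length qs
    len = map≡⇒length≡ ps qs reds≡

    to : Fin (pts G) → Fin (pts H)
    to x = lookup qs (cast len (Any.index (ps-full x)))

    from : Fin (pts H) → Fin (pts G)
    from y = lookup ps (cast (sym len) (Any.index (qs-full y)))

    index-lookup : ∀ {n} {xs : List (Fin n)} → Unique xs → (full : ∀ x → x ∈ xs) →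
                   ∀ i → Any.index (full (lookup xs i)) ≡ i
    index-lookup {xs = xs} xs! full i = lookup-injective xs! _ _ (sym (lookup-index (full (lookup xs i))))

    to-from : ∀ y → to (from y) ≡ y
    to-from y = trans (cong (λ i → lookup qs (cast len i)) (index-lookup ps! ps-full _))
               (trans (cong (lookup qs) (Fin.cast-involutive len (sym len) _)) (sym (lookup-index (qs-full y))))

    from-to : ∀ x → from (to x) ≡ x
    from-to x = trans (cong (λ i → lookup ps (cast (sym len) i)) (index-lookup qs! qs-full _))
               (trans (cong (lookup ps) (Fin.cast-involutive (sym len) len _)) (sym (lookup-index (ps-full x))))

    to-preserves : ∀ {f : Fin (pts G) → C} {g : Fin (pts H) → C} → map f ps ≡ map g qs → ∀ x → f x ≡ g (to x)
    to-preserves {f = f} eq x = trans (cong f (lookup-index (ps-full x))) (lookup-map≡ eq len (Any.index (ps-full x)))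

    toLine : ∀ l → ∃[ m ] TG.trace l ps ≡ TH.trace m qs
    toLine l = let m , _ , eq = TH.Presents.sound presH (TG.Presents.complete presG (line-secant G flsG ps-full l))
               in m , eq

    fromLine : ∀ m → ∃[ l ] TH.trace m qs ≡ TG.trace l ps
    fromLine m = let l , _ , eq = TG.Presents.sound presG (TH.Presents.complete presH (line-secant H flsH qs-full m))
                 in l , eq

  -- Points correspond by their positions in `ps` and `qs`, lines by equal traces; as both lists
  -- contain all points, a trace determines its line.
  iso : Iso G H
  iso = record
    { ptIso = mk↔ₛ′ to from to-from from-to
    ; lineIso = mk↔ₛ′ (proj₁ ∘ toLine) (proj₁ ∘ fromLine)
        (λ m → sym (TH.trace-injective (line-secant H flsH qs-full m) (trans (proj₂ (fromLine m)) (proj₂ (toLine _)))))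
        (λ l → sym (TG.trace-injective (line-secant G flsG ps-full l) (trans (proj₂ (toLine l)) (proj₂ (fromLine _)))))
    ; incid = λ x l →
        (λ x∈ → TH.inc⇒∈ (subst T (to-preserves (proj₂ (toLine l)) x) (TG.∈⇒inc x∈)))
      , (λ x∈ → TG.inc⇒∈ (subst T (sym (to-preserves (proj₂ (toLine l)) x)) (TH.∈⇒inc x∈)))
    ; colours = λ x → isRed-injective (sym (to-preserves reds≡ x)) }

-- Interchanging the colours

swap-MR : ∀ {G} → IsMR G → IsMR (swapColours G)
swap-MR mr = record
  { fls = record { lineSize = lineSize ; unique = unique ; twoPoints = twoPoints ; notOneLine = notOneLine }
  ; hasRed = λ l → let x , x∈ , eq = IsMR.hasGreen mr l in x , x∈ , cong swapColour eq
  ; hasGreen = λ l → let x , x∈ , eq = IsMR.hasRed mr l in x , x∈ , cong swapColour eq }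
  where open IsFLS (IsMR.fls mr)

swap-Iso : ∀ {G H} → Iso (swapColours G) H → Iso G (swapColours H)
swap-Iso {G} i = record { ptIso = ptIso ; lineIso = lineIso ; incid = incid
  ; colours = λ x → trans (cong swapColour (colours x)) (swapColour-involutive (colour G x)) }
  where open Iso i

unswap-Iso : ∀ {G H} → Iso (swapColours G) (swapColours H) → Iso G H
unswap-Iso {G} {H} i = record { ptIso = ptIso ; lineIso = lineIso ; incid = incid
  ; colours = λ x → trans (sym (swapColour-involutive _))
                     (trans (cong swapColour (colours x)) (swapColour-involutive (colour G x))) }
  where open Iso i

-- The classification

-- The first two alternatives contradict the axioms of a linear space.
acceptable : List (Row × Table) → Row → Table → Bool
acceptable targets reds t = (length reds <ᵇ 2) ∨ any (all id) t ∨ any (isomorphic (reds , t)) targets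

searchAll : ℕ → ℕ → List (Row × Table) → Bool
searchAll g v targets =
  all (λ k → all (explore (acceptable targets) (v ∸ k) (replicate k false)) (linearSpaces k)) (upTo (suc g))

module Classification {k} (M : Fin k → Geom) (M-MR : ∀ i → IsMR (M i)) (v : ℕ) where

  Goal : Geom → Set
  Goal G = Σ[ i ∈ Fin k ] (Iso G (M i) ⊎ Iso G (swapColours (M i)))

  targets : List (Row × Table)
  targets = map (tableOf ∘ M) (allFin k) ++ map (tableOf ∘ swapColours ∘ M) (allFin k)

  module _ {G : Geom} (mr : IsMR G) where
    open Traces G (IsMR.fls mr)

    private
      target-Iso : ∀ {H ps t} → IsMR H → Unique ps → (∀ x → x ∈ ps) → Presents ps t →
                   T (isomorphic (map (isRed ∘ colour G) ps , t) (tableOf H)) → Iso G H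
      target-Iso {H} {ps} mrH ps! full pres e
        with ks , reds≡ , match ← isomorphic-sound {s = redRow H} e =
        SameTable.iso G H (IsMR.fls mr) (IsMR.fls mrH)
          (Unique-resp-↭ (setoid _) (↭⇒↭ₛ (↭-sym (permute-↭ ks ps))) ps!) (allFin⁺ _)
          (λ x → ∈-resp-↭ (↭-sym (permute-↭ ks ps)) (full x)) ∈-allFin
          (permute-presents G (IsMR.fls mr) {ks} match pres) (tableOf-presents H (IsMR.fls mrH))
          (trans (sym (permute-map (isRed ∘ colour G) ks ps)) reds≡)

    acceptable-sound : ∀ {ps t} → Unique ps → (∀ x → x ∈ ps) → Presents ps t →
                       T (acceptable targets (map (isRed ∘ colour G) ps) t) → Goal G
    acceptable-sound {ps} {t} ps! full pres e with T-∨⁻ {length (map (isRed ∘ colour G) ps) <ᵇ 2} e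
    ... | inj₁ few = contradiction
      (ℕ.≤-trans (IsFLS.twoPoints (IsMR.fls mr))
        (ℕ.≤-trans enough (ℕ.≤-reflexive (sym (length-map (isRed ∘ colour G) ps)))))
      (ℕ.<⇒≱ (ℕ.<ᵇ⇒< _ 2 few))
      where
      enough : pts G ≤ length ps
      enough = Fin.injective⇒≤ {f = λ x → Any.index (full x)}
        (λ {x} {y} eq → trans (lookup-index (full x)) (trans (cong (lookup ps) eq) (sym (lookup-index (full y)))))
    ... | inj₂ e′ with T-∨⁻ {any (all id) t} e′
    ...   | inj₁ oneLine with any⁻ (all id) t oneLine
    ...     | R , R∈ , allR with Presents.sound pres R∈
    ...       | l , _ , refl =
      contradiction (l , λ x → inc⇒∈ (all⁻ id allR (∈-map⁺ (incident G l) (full x)))) (IsFLS.notOneLine (IsMR.fls mr))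
    acceptable-sound {ps} {t} ps! full pres e | inj₂ e′ | inj₂ e″
      with any⁻ (isomorphic (map (isRed ∘ colour G) ps , t)) targets e″
    ... | u , u∈ , e‴ with ∈-++⁻ (map (tableOf ∘ M) (allFin k)) u∈
    ...   | inj₁ u∈′ with ∈-map⁻ (tableOf ∘ M) u∈′
    ...     | i , _ , refl = i , inj₁ (target-Iso (M-MR i) ps! full pres e‴)
    acceptable-sound {ps} {t} ps! full pres e | inj₂ e′ | inj₂ e″ | u , u∈ , e‴ | inj₂ u∈′
      with ∈-map⁻ (tableOf ∘ swapColours ∘ M) u∈′
    ... | i , _ , refl = i , inj₂ (target-Iso (swap-MR (M-MR i)) ps! full pres e‴)

  isGreen : Colour → Bool
  isGreen c = not (isRed c)

  greenPoints : ∀ G → List (Fin (pts G))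
  greenPoints G = filterᵇ (isGreen ∘ colour G) (allFin (pts G))

  classify-few-greens : ∀ {G} → IsMR G → pts G ≤ v → ∀ {g} → g ≤ v → searchAll g v targets ≡ true →
                        length (greenPoints G) ≤ g → Goal G
  classify-few-greens {G} mr pts≤v {g} g≤v search few
    with linearSpaces-complete G (IsMR.fls mr) (filter⁺ (T? ∘ isGreen ∘ colour G) (allFin⁺ (pts G)))
  ... | ps , t , t∈ , ps↭ , pres =
    explore-sound (acceptable-sound mr) state
      (subst (λ r → T (explore (acceptable targets) (v ∸ n) r t)) (sym reds≡)
        (all⁻ _ (all≡true⁻ (λ k → all (explore (acceptable targets) (v ∸ k) (replicate k false)) (linearSpaces k))
                           (upTo (suc g)) search (∈-upTo⁺ (s≤s few))) t∈))
    where
    open Traces G (IsMR.fls mr)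
    open Search G mr v pts≤v (acceptable targets) (Goal G)
    n = length (greenPoints G)
    green⁺ : ∀ x → ¬ T (isRed (colour G x)) → x ∈ ps
    green⁺ x ¬r = ∈-resp-↭ (↭-sym ps↭) (∈-filterᵇ⁺ (isGreen ∘ colour G) (∈-allFin x) (¬T⇒T-not ¬r))
    all-green : ∀ xs → (∀ {x} → x ∈ xs → T (isGreen (colour G x))) →
                map (isRed ∘ colour G) xs ≡ replicate (length xs) false
    all-green [] _ = refl
    all-green (x ∷ xs) gr = cong₂ _∷_ (¬T⇒≡false (T-not⇒¬T (gr (here refl)))) (all-green xs (gr ∘ there))
    reds≡ : map (isRed ∘ colour G) ps ≡ replicate n false
    reds≡ = trans (all-green ps λ x∈ → proj₂ (∈-filterᵇ⁻ (isGreen ∘ colour G) (allFin (pts G)) (∈-resp-↭ ps↭ x∈)))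
                  (cong (λ k → replicate k false) (↭-length ps↭))
    state : State (acceptable-sound mr) (v ∸ n) ps t
    state = record
      { uniq = Unique-resp-↭ (setoid _) (↭⇒↭ₛ (↭-sym ps↭)) (filter⁺ (T? ∘ isGreen ∘ colour G) (allFin⁺ (pts G)))
      ; greens = green⁺
      ; count = trans (cong (_+ (v ∸ n)) (↭-length ps↭)) (ℕ.m+[n∸m]≡n (ℕ.≤-trans few g≤v))
      ; table = pres }

  greens+swapped : ∀ G → length (greenPoints G) + length (greenPoints (swapColours G)) ≡ pts G
  greens+swapped G = trans (split (allFin (pts G))) (length-tabulate id)
    where
    split : ∀ xs → length (filterᵇ (isGreen ∘ colour G) xs) +
                   length (filterᵇ (isGreen ∘ colour (swapColours G)) xs) ≡ length xs
    split [] = refl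
    split (x ∷ xs) with colour G x
    ... | red = trans (ℕ.+-suc _ _) (cong suc (split xs))
    ... | green = cong suc (split xs)

  swap-Goal : ∀ {G} → Goal (swapColours G) → Goal G
  swap-Goal (i , inj₁ iso) = i , inj₂ (swap-Iso iso)
  swap-Goal (i , inj₂ iso) = i , inj₁ (unswap-Iso iso)

  -- More than `g` points of each colour would give at least `2g + 2` points, exceeding `v`. So `G`
  -- or its colour swap has at most `g` green points.
  classify : ∀ {g} → v ≤ g + suc g → g ≤ v → searchAll g v targets ≡ true →
             ∀ G → pts G ≤ v → IsMR G → Goal G
  classify {g} v≤ g≤v search G pts≤v mr with length (greenPoints G) ≤? g
  ... | yes few = classify-few-greens mr pts≤v g≤v search few
  ... | no many = swap-Goal (classify-few-greens (swap-MR mr) pts≤v g≤v search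
        (ℕ.+-cancelˡ-≤ (suc g) _ _ (ℕ.≤-trans (ℕ.+-monoˡ-≤ _ (ℕ.≰⇒> many))
          (ℕ.≤-trans (ℕ.≤-reflexive (greens+swapped G)) (ℕ.≤-trans pts≤v (ℕ.≤-trans v≤ (ℕ.≤-reflexive (ℕ.+-suc g g))))))))

-- Recognising MR geometries

goodLine : Row → Row → Bool
goodLine reds R = (1 <ᵇ size R) ∧ meets reds R ∧ meets (map not reds) R ∧ any not R

-- Entries of the table are counted with repetition, so a count of one gives uniqueness of the line
-- as an index, not merely as a set of points.
joinedOnce : Table → Row → Row → Bool
joinedOnce t d e = same d e ∨ (length (filterᵇ (λ R → meets d R ∧ meets e R) t) ≡ᵇ 1)

pairwise : (Row → Row → Bool) → List Row → Bool
pairwise r es = all (λ d → all (r d) es) es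

valid : Row × Table → Bool
valid (reds , t) =
  (1 <ᵇ length reds) ∧ all (goodLine reds) t ∧ pairwise (joinedOnce t) (singletons∉ (map (λ _ → false) reds))

filterᵇ-map : ∀ (p : B → Bool) (f : A → B) xs → filterᵇ p (map f xs) ≡ map f (filterᵇ (p ∘ f) xs)
filterᵇ-map p f [] = refl
filterᵇ-map p f (x ∷ xs) with p (f x)
... | true = cong (f x ∷_) (filterᵇ-map p f xs)
... | false = filterᵇ-map p f xs

map-allFin-lookup : ∀ {n} (S : Vec.Vec A n) → map (Vec.lookup S) (allFin n) ≡ Vec.toList S
map-allFin-lookup S = trans (map-tabulate id (Vec.lookup S)) (tabulate-lookup S)
  where
  tabulate-lookup : ∀ {n} (S : Vec.Vec A n) → tabulate (Vec.lookup S) ≡ Vec.toList S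
  tabulate-lookup Vec.[] = refl
  tabulate-lookup (x Vec.∷ S) = cong (x ∷_) (tabulate-lookup S)

singleton-∈ : ∀ (xs : List A) → length xs ≡ 1 → ∃[ x ] x ∈ xs × (∀ {y} → y ∈ xs → y ≡ x)
singleton-∈ (x ∷ []) _ = x , here refl , λ { (here eq) → eq }

valid-sound : ∀ G → T (valid (tableOf G)) → IsMR G
valid-sound G e
  with v≥2 , e₁ ← T-∧⁻ {1 <ᵇ length (redRow G)} e
  with lines , pairs ← T-∧⁻ {all (goodLine (redRow G)) (proj₂ (tableOf G))} e₁ = record
  { fls = record
    { lineSize = λ l → subst (2 ≤_) (trans (cong size (map-allFin-lookup (line G l))) (size-toList (line G l)))
                               (ℕ.<ᵇ⇒< 1 _ (proj₁ (line-ok l)))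
    ; unique = unique
    ; twoPoints = subst (2 ≤_) (trans (length-map (isRed ∘ colour G) (allFin (pts G))) (length-tabulate id)) (ℕ.<ᵇ⇒< 1 _ v≥2)
    ; notOneLine = λ { (l , full) → not-full l full } }
  ; hasRed = λ l → let x , _ , rx , lx = meets⁻ isRedAt (incident G l) points (proj₁ (proj₂ (line-ok l)))
                   in x , lookup⇒[]= x (line G l) (T⇒≡true lx) , red⁺ rx
  ; hasGreen = λ l → let x , _ , gx , lx = meets⁻ (not ∘ isRedAt) (incident G l) points
                               (subst (λ r → T (meets r (row l))) (sym (map-∘ points)) (proj₁ (proj₂ (proj₂ (line-ok l)))))
                     in x , lookup⇒[]= x (line G l) (T⇒≡true lx) , green⁺ gx }
  where
  points = allFin (pts G)
  isRedAt : Fin (pts G) → Bool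
  isRedAt = isRed ∘ colour G
  row : Fin (nlines G) → Row
  row l = map (incident G l) points
  red⁺ : ∀ {c} → T (isRed c) → c ≡ red
  red⁺ {red} _ = refl
  green⁺ : ∀ {c} → T (not (isRed c)) → c ≡ green
  green⁺ {green} _ = refl
  line-ok : ∀ l → T (1 <ᵇ size (row l)) × T (meets (redRow G) (row l)) ×
                  T (meets (map not (redRow G)) (row l)) × T (any not (row l))
  line-ok l =
    let p , q = T-∧⁻ {1 <ᵇ size (row l)} (all⁻ (goodLine (redRow G)) lines (∈-map⁺ row (∈-allFin l)))
        q₁ , r = T-∧⁻ {meets (redRow G) (row l)} q
    in p , q₁ , T-∧⁻ r
  not-full : ∀ l → ¬ (∀ x → x Subset.∈ line G l)
  not-full l full with any⁻ not (row l) (proj₂ (proj₂ (proj₂ (line-ok l))))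
  ... | b , b∈ , ¬b with ∈-map⁻ (incident G l) b∈
  ...   | x , _ , refl = T-not⇒¬T ¬b (subst T (sym ([]=⇒lookup (full x))) _)
  unique : ∀ x y → x ≢ y → Σ[ l ∈ Fin (nlines G) ] ((x Subset.∈ line G l × y Subset.∈ line G l) ×
             (∀ l′ → x Subset.∈ line G l′ → y Subset.∈ line G l′ → l′ ≡ l))
  unique x y x≢y = conclude (singleton-∈ common one)
    where
    singleton : Fin (pts G) → Row
    singleton x = map (point _≟F_ x) points
    joins : Row → Bool
    joins R = meets (singleton x) R ∧ meets (singleton y) R
    common : List (Fin (nlines G))
    common = filterᵇ (joins ∘ row) (allFin (nlines G))
    singletons : List Row
    singletons = singletons∉ (map (λ _ → false) (redRow G))
    singleton∈ : ∀ x → singleton x ∈ singletons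
    singleton∈ x = subst (λ r → singleton x ∈ singletons∉ r) (map-∘ points)
                     (singletons∉⁺ _≟F_ (λ _ → false) (allFin⁺ (pts G)) (∈-allFin x) id)
    one : length common ≡ 1
    one with T-∨⁻ {same (singleton x) (singleton y)}
      (all⁻ (joinedOnce (proj₂ (tableOf G)) (singleton x))
        (all⁻ (λ d → all (joinedOnce (proj₂ (tableOf G)) d) singletons) pairs (singleton∈ x)) (singleton∈ y))
    ... | inj₁ x=y = contradiction (sym (point⇒≡ _≟F_ (subst T x-in-y (point-refl _≟F_ x)))) x≢y
      where
      x-in-y : point _≟F_ x x ≡ point _≟F_ y x
      x-in-y = map-injective-∈ (same⇒≡ (singleton x) (singleton y) x=y) (∈-allFin x)
    ... | inj₂ len = trans (sym (length-map row common))
                       (trans (cong length (sym (filterᵇ-map joins row (allFin (nlines G))))) (ℕ.≡ᵇ⇒≡ _ 1 len))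
    on : ∀ {z l} → T (meets (singleton z) (row l)) → z Subset.∈ line G l
    on {z} {l} m with meets⁻ (point _≟F_ z) (incident G l) points m
    ... | w , _ , zw , lw with refl ← point⇒≡ _≟F_ {z} {w} zw = lookup⇒[]= z (line G l) (T⇒≡true lw)
    off : ∀ {z l} → z Subset.∈ line G l → T (meets (singleton z) (row l))
    off {z} {l} z∈ = meets⁺ (point _≟F_ z) (incident G l) (∈-allFin z) (point-refl _≟F_ z) (subst T (sym ([]=⇒lookup z∈)) _)
    conclude : (∃[ l ] l ∈ common × (∀ {m} → m ∈ common → m ≡ l)) → _
    conclude (l , l∈ , uniq) =
      let x-on , y-on = T-∧⁻ {meets (singleton x) (row l)} (proj₂ (∈-filterᵇ⁻ (joins ∘ row) (allFin (nlines G)) l∈))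
      in l , (on x-on , on y-on)
         , λ m x∈ y∈ → uniq (∈-filterᵇ⁺ (joins ∘ row) (∈-allFin m) (T-∧⁺ (off {x} {m} x∈) (off {y} {m} y∈)))

-- The invariant

∑ : ∀ {n} → (Fin n → ℕ) → ℕ
∑ {n} f = sum (map f (allFin n))

∑-cong : ∀ {n} {f g : Fin n → ℕ} → (∀ i → f i ≡ g i) → ∑ f ≡ ∑ g
∑-cong {n} eq = cong sum (map-cong-∈ (allFin n) (λ i _ → eq i))

-- The images of all indices form a list without repetitions that contains every index, hence a
-- permutation of `allFin n`.
∑-reindex : ∀ {m n} (π : Fin m ↔ Fin n) (f : Fin n → ℕ) → ∑ (f ∘ Inverse.to π) ≡ ∑ f
∑-reindex {m} {n} π f = trans (cong sum (map-∘ (allFin m))) (sum-↭ (map⁺ f (∼bag⇒↭ (unique∧set⇒bag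
  (Unique-map⁺ to-injective (allFin⁺ m)) (allFin⁺ n)
  (λ {y} → mk⇔ (λ _ → ∈-allFin y) (λ _ → subst (_∈ map to (allFin m)) (strictlyInverseˡ y) (∈-map⁺ to (∈-allFin (from y)))))))))
  where
  open Inverse π
  to-injective : ∀ {x y} → to x ≡ to y → x ≡ y
  to-injective {x} {y} eq = trans (sym (strictlyInverseʳ x)) (trans (cong from eq) (strictlyInverseʳ y))

indicator : Bool → ℕ
indicator b = if b then 1 else 0

overlapSize : Row → Row → ℕ
overlapSize R S = sum (map indicator (zipWith _∧_ R S))

cubesOf : Row × Table → ℕ
cubesOf (r , t) = sum (map (λ R → overlapSize R r ^ 3 + overlapSize R (map not r) ^ 3) t)

coloured : (G : Geom) → (Colour → Bool) → Fin (nlines G) → ℕ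
coloured G p l = ∑ λ x → indicator (incident G l x ∧ p (colour G x))

-- This counts triples of equally coloured points, repetitions allowed, once for each line
-- containing them. Both colours enter alike, so interchanging them preserves it.
cubes : Geom → ℕ
cubes G = ∑ λ l → coloured G isRed l ^ 3 + coloured G (not ∘ isRed) l ^ 3

overlapSize-map : ∀ (f g : A → Bool) xs →
                  overlapSize (map f xs) (map g xs) ≡ sum (map (λ x → indicator (f x ∧ g x)) xs)
overlapSize-map f g [] = refl
overlapSize-map f g (x ∷ xs) = cong (indicator (f x ∧ g x) +_) (overlapSize-map f g xs)

cubesOf-tableOf : ∀ G → cubesOf (tableOf G) ≡ cubes G
cubesOf-tableOf G = trans (cong sum (sym (map-∘ (allFin (nlines G))))) (∑-cong λ l →
  cong₂ (λ r g → r ^ 3 + g ^ 3)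
    (overlapSize-map (incident G l) (isRed ∘ colour G) (allFin (pts G)))
    (trans (cong (overlapSize (map (incident G l) (allFin (pts G)))) (sym (map-∘ (allFin (pts G)))))
           (overlapSize-map (incident G l) (not ∘ isRed ∘ colour G) (allFin (pts G)))))

T-ext : ∀ {b c} → (T b → T c) → (T c → T b) → b ≡ c
T-ext {true} f _ = sym (T⇒≡true (f _))
T-ext {false} {true} _ g = ⊥-elim (g _)
T-ext {false} {false} _ _ = refl

incident⇔ : ∀ {G H : Geom} {l m x y} →
            (x Subset.∈ line G l → y Subset.∈ line H m) × (y Subset.∈ line H m → x Subset.∈ line G l) →
            incident G l x ≡ incident H m y
incident⇔ {G} {H} {l} {m} {x} {y} (f , g) = T-ext
  (λ t → subst T (sym ([]=⇒lookup (f (lookup⇒[]= x (line G l) (T⇒≡true t))))) _)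
  (λ t → subst T (sym ([]=⇒lookup (g (lookup⇒[]= y (line H m) (T⇒≡true t))))) _)

cubes-Iso : ∀ {G H} → Iso G H → cubes G ≡ cubes H
cubes-Iso {G} {H} i = trans 
  (∑-cong λ l → cong₂ (λ r g → r ^ 3 + g ^ 3) (coloured-Iso isRed l) (coloured-Iso (not ∘ isRed) l))
  (∑-reindex lineIso _)
  where
  open Iso i
  coloured-Iso : ∀ p l → coloured G p l ≡ coloured H p (Inverse.to lineIso l)
  coloured-Iso p l = trans
    (∑-cong λ x → cong₂ (λ b c → indicator (b ∧ p c)) (incident⇔ {G} {H} (incid x l)) (sym (colours x)))
    (∑-reindex ptIso (λ y → indicator (incident H (Inverse.to lineIso l) y ∧ p (colour H y))))

cubes-swap : ∀ G → cubes (swapColours G) ≡ cubes G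
cubes-swap G = ∑-cong λ l → trans (cong₂ (λ r g → r ^ 3 + g ^ 3) (red-swap l) (green-swap l))
                                  (ℕ.+-comm (coloured G (not ∘ isRed) l ^ 3) (coloured G isRed l ^ 3))
  where
  red-swap : ∀ l → coloured (swapColours G) isRed l ≡ coloured G (not ∘ isRed) l
  red-swap l = ∑-cong λ x → cong (λ b → indicator (incident G l x ∧ b)) (isRed-swap (colour G x))
  green-swap : ∀ l → coloured (swapColours G) (not ∘ isRed) l ≡ coloured G isRed l
  green-swap l = ∑-cong λ x → cong (λ b → indicator (incident G l x ∧ b))
    (trans (cong not (isRed-swap (colour G x))) (not-involutive (isRed (colour G x))))

-- The geometries of the list

MRlist-MR : ∀ i → IsMR (MRlist i)
MRlist-MR i = valid-sound (MRlist i)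
  (all≡true⁻ (λ i → valid (tableOf (MRlist i))) (allFin 10) all-valid (∈-allFin i))
  where
  all-valid : all (λ i → valid (tableOf (MRlist i))) (allFin 10) ≡ true
  all-valid = refl

-- The second entry, for instance, belongs to `MR13`: six lines have three green points and one red,
-- three have two of each, and four have one green point and three red, so the sum is 6 · 28 + 3 ·
-- 16 + 4 · 28 = 328.
cubeSums : Vec.Vec ℕ 10
cubeSums = 276 Vec.∷ 328 Vec.∷ 406 Vec.∷ 405 Vec.∷ 471 Vec.∷ 455 Vec.∷ 464 Vec.∷ 470 Vec.∷ 477 Vec.∷ 476 Vec.∷ Vec.[]

cubes-MRlist : ∀ i → cubes (MRlist i) ≡ Vec.lookup cubeSums i
cubes-MRlist i = trans (sym (cubesOf-tableOf (MRlist i)))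
  (ℕ.≡ᵇ⇒≡ _ _ (all≡true⁻ (λ i → cubesOf (tableOf (MRlist i)) ≡ᵇ Vec.lookup cubeSums i)
                         (allFin 10) all-equal (∈-allFin i)))
  where
  all-equal : all (λ i → cubesOf (tableOf (MRlist i)) ≡ᵇ Vec.lookup cubeSums i) (allFin 10) ≡ true
  all-equal = refl

cubeSums-injective : ∀ i j → Vec.lookup cubeSums i ≡ Vec.lookup cubeSums j → i ≡ j
cubeSums-injective = toWitness
  {a? = Fin.all? λ i → Fin.all? λ j → (Vec.lookup cubeSums i ℕ.≟ Vec.lookup cubeSums j) →-dec (i ≟F j)} _

-- The entire case analysis is evaluated by this `refl`. The bound 7 fits since 15 = 7 + 8, so one
-- colour has at most 7 points.
search-succeeds : searchAll 7 15 (Classification.targets MRlist MRlist-MR 15) ≡ true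
search-succeeds = refl

theorem2p12 : ((i : Fin 10) → IsMR (MRlist i))
    × ((G : Geom) → pts G ≤ 15 → IsMR G →
    Σ[ i ∈ Fin 10 ] (Iso G (MRlist i) ⊎ Iso G (swapColours (MRlist i))))
    × ((i j : Fin 10) → Iso (MRlist i) (MRlist j) ⊎ Iso (MRlist i) (swapColours (MRlist j)) → i ≡ j)
theorem2p12 = MRlist-MR
  , Classification.classify MRlist MRlist-MR 15 {7} ℕ.≤-refl (toWitness {a? = 7 ≤? 15} _) search-succeeds
  , λ i j iso → cubeSums-injective i j (trans (sym (cubes-MRlist i)) (trans (cubes≡ j iso) (cubes-MRlist j)))
  where
  cubes≡ : ∀ {G} j → Iso G (MRlist j) ⊎ Iso G (swapColours (MRlist j)) → cubes G ≡ cubes (MRlist j)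
  cubes≡ j (inj₁ iso) = cubes-Iso iso
  cubes≡ j (inj₂ iso) = trans (cubes-Iso iso) (cubes-swap (MRlist j))
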